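{- Let $n\ge 2$, let $v\in \tilde{S}_n$ and let $r\in\mathbb{Z}$. Then \[ \sum_{u\in \Psi_r^-(v)} \tilde{F}_u(X) \;=\; \sum_{w\in \Psi_r^+(v)} \tilde{F}_w(X). \]
   Context: The affine symmetric group $\tilde{S}_n$ is the set of bijections $w:\mathbb{Z}\to\mathbb{Z}$ with $w(i+n)=w(i)+n$ for all $i$ and $\sum_{i=1}^n w(i)=\sum_{i=1}^n i$. It is a Coxeter group with simple reflections $s_i$, $i\in\mathbb{Z}/n\mathbb{Z}$, where $s_i$ swaps $i+kn$ and $i+1+kn$ for all $k$ and fixes all other integers. For integers $r,s$ with $s\not\equiv r \pmod n$, $t_{r,s}\in\tilde{S}_n$ is the unique element with $t_{r,s}(r)=s$, $t_{r,s}(s)=r$, and $t_{r,s}(i)=i$ for $i\not\equiv r,s \pmod n$. The length $\ell(w)$ is the minimal $l$ such that $w=s_{a_1}\cdots s_{a_l}$; such a word $a_1\cdots a_l$ is a reduced word. Write $v\lessdot w$ if $w=vt_{r,s}$ for some such reflection and $\ell(w)=\ell(v)+1$. The element $w$ is a right $r$-cover of $v$ if $v\lessdot w$ and $w=vt_{r,s}$ with $r<s$; it is a left $r$-cover of $v$ if $v\lessdot w$ and $w=vt_{s,r}$ with $s<r$. $\Psi^+_r(v)$ is the set of right $r$-covers of $v$ and $\Psi^-_r(v)$ the set of left $r$-covers. A reduced word $a_1\cdots a_l$ (letters in $\mathbb{Z}/n\mathbb{Z}$) is cyclically decreasing if its letters are distinct and whenever $i,i+1$ (mod $n$) both occur,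 $i+1$ occurs before $i$. An element of $\tilde{S}_n$ is cyclically decreasing if it has a cyclically decreasing reduced word. For a composition $\alpha=(\alpha_1,\dots,\alpha_m)$ of $\ell(w)$, an $\alpha$-decomposition of $w$ is an $m$-tuple $(w^1,\dots,w^m)$ of cyclically decreasing elements with $\ell(w^i)=\alpha_i$ and $w=w^1\cdots w^m$. The affine Stanley symmetric function is $\tilde{F}_w(X)=\sum_\alpha N_\alpha(w)\,x^\alpha$, summed over compositions $\alpha$ of $\ell(w)$, where $N_\alpha(w)$ is the number of $\alpha$-decompositions of $w$ and $x^\alpha=x_1^{\alpha_1}x_2^{\alpha_2}\cdots$. -}

module Defs where

open import Level using (0ℓ)
open import Data.Bool.Base using (if_then_else_)
open import Data.Fin.Base as Fin using (Fin; zero; suc; toℕ; fromℕ<)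
open import Data.Fin.Permutation as Perm using (Permutation)
open import Data.Fin.Properties as Fin using (toℕ-injective; toℕ-fromℕ<; toℕ<n; all?)
open import Data.Integer.Base hiding (suc; _⊔_)
open import Data.Integer.DivMod using (_%ℕ_; _/ℕ_; n%ℕd<d; a≡a%ℕn+[a/ℕn]*n)
open import Data.Integer.Divisibility.Signed using (_∣_; divides; _∣?_; ∣⇒∣ᵤ)
open import Data.Integer.Properties as ℤ hiding (_≟_; ≡-setoid; ≡-decSetoid)
open import Data.Integer.Tactic.RingSolver using (solve-∀)
open import Data.List.Base as List using (List; []; _∷_; _++_; length; foldr; map; filter; deduplicate; allFin; cartesianProductWith; replicate)
open import Data.List.Membership.Propositional as Mem using (find; lose)
open import Data.List.Membership.Propositional.Properties as Mem using (∈-allFin)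
import Data.List.Membership.Setoid as SMem
import Data.List.Membership.Setoid.Properties as SMem
open import Data.List.Relation.Binary.Pointwise as Pointwise using (Pointwise; []; _∷_)
open import Data.List.Relation.Unary.Any as Any using (here; there)
import Data.List.Relation.Unary.Any.Properties as Any
import Data.List.Relation.Unary.Unique.Setoid as Unique
import Data.List.Relation.Unary.Unique.Setoid.Properties as Unique
import Data.List.Relation.Unary.Unique.DecSetoid.Properties as Unique
open import Data.List.Relation.Unary.Unique.Propositional using () renaming (Unique to Distinct)
import Data.List.Relation.Unary.Unique.DecPropositional as DecUnique
open import Data.Nat.Base as ℕ using (ℕ; zero; suc; z≤n; s≤s)
import Data.Nat.Divisibility as ℕ
open import Data.Nat.DivMod using (_mod_)
import Data.Nat.ListAction as ℕ
import Data.Nat.Properties as ℕ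
open import Data.Product using (Σ; ∃; ∃₂; _×_; _,_; proj₁; proj₂)
open import Data.Sum.Base using (_⊎_; inj₁; inj₂)
open import Function.Base using (_∘_; id)
open import Function.Bundles using (_↔_; Inverse; mk↔ₛ′)
open import Relation.Binary.Bundles using (Setoid; DecSetoid)
open import Relation.Binary.Definitions using (_Respects_)
open import Relation.Binary.PropositionalEquality as ≡ hiding (setoid; decSetoid; [_])
open import Relation.Nullary using (¬_; Dec; yes; no; does; contradiction)
open import Relation.Nullary.Decidable as Dec using (_×-dec_; _→-dec_)
open import Relation.Unary using (Pred; Decidable)
open import Algebra.Properties.CommutativeMonoid.Sum ℤ.+-0-commutativeMonoid
  using (sum-syntax; sum-cong-≗; ∑-distrib-+; ∑-permute)

record Finite (S : Setoid 0ℓ 0ℓ) (P : Pred (Setoid.Carrier S) 0ℓ) : Set where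
  open Setoid S using (Carrier)
  field
    elements : List Carrier
    distinct : Unique.Unique S elements
    sound    : ∀ {x} → SMem._∈_ S x elements → P x
    complete : ∀ {x} → P x → SMem._∈_ S x elements

  card : ℕ
  card = length elements

open Finite public using (elements; card)

finite : (D : DecSetoid 0ℓ 0ℓ) (let open DecSetoid D) {P : Pred Carrier 0ℓ} →
         Decidable P → P Respects _≈_ →
         (xs : List Carrier) → (∀ {x} → P x → SMem._∈_ setoid x xs) →
         Finite setoid P
finite D P? resp xs covers = record
  { elements = filter P? (deduplicate _≟_ xs)
  ; distinct = Unique.filter⁺ setoid P? (Unique.deduplicate-! D xs)
  ; sound    = λ x∈ → proj₂ (SMem.∈-filter⁻ setoid P? resp {xs = deduplicate _≟_ xs} x∈)
  ; complete = λ p → SMem.∈-filter⁺ setoid P? resp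
      (SMem.∈-deduplicate⁺ setoid _≟_ (λ z≈y x≈y → trans′ x≈y (sym′ z≈y)) (covers p)) p
  }
  where
  open DecSetoid D renaming (sym to sym′; trans to trans′)

choices : ∀ {A : Set} → List (List A) → List (List A)
choices = foldr (cartesianProductWith _∷_) ([] ∷ [])

-- A formal power series in x₁, x₂, … as its coefficient function: the list
-- α₁ ∷ … ∷ αₘ ∷ [] is the exponent vector of x₁^α₁ ⋯ xₘ^αₘ.  Parts may be 0,
-- so that every monomial occurs; trailing zeros do not change the monomial,
-- and F̃ below takes the same value with and without them because ε is the
-- only element of length 0.

Series : Set
Series = List ℕ → ℕ

infix 5 ∑∈-syntax
∑∈-syntax : {S : Setoid 0ℓ 0ℓ} {P : Pred (Setoid.Carrier S) 0ℓ} →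
            Finite S P → (Setoid.Carrier S → Series) → Series
∑∈-syntax X F α = ℕ.sum (map (λ x → F x α) (elements X))

syntax ∑∈-syntax X (λ x → f) = ∑[ x ∈ X ] f

least : {P : Pred ℕ 0ℓ} → Decidable P → ∀ m → P m →
        ∃ λ l → P l × (∀ k → P k → l ℕ.≤ k)
least {P} P? m Pm with go m
  where
  go : ∀ m → (∃ λ l → P l × (∀ k → P k → l ℕ.≤ k)) ⊎ (∀ k → k ℕ.≤ m → ¬ P k)
  go zero with P? 0
  ... | yes p = inj₁ (0 , p , λ _ _ → z≤n)
  ... | no ¬p = inj₂ λ { .0 z≤n → ¬p }
  go (suc m) with go m
  ... | inj₁ l = inj₁ l
  ... | inj₂ none with P? (suc m)
  ...   | yes p = inj₁ (suc m , p , λ k Pk → ℕ.≰⇒> (λ k≤m → none k k≤m Pk))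
  ...   | no ¬p = inj₂ below
    where
    below : ∀ k → k ℕ.≤ suc m → ¬ P k
    below k k≤ Pk with ℕ.m≤n⇒m<n∨m≡n k≤
    ... | inj₁ (s≤s k≤m) = none k k≤m Pk
    ... | inj₂ refl      = ¬p Pk
... | inj₁ l    = l
... | inj₂ none = contradiction Pm (none m ℕ.≤-refl)

∑-const : ∀ m c → ∑[ k < m ] c ≡ + m * c
∑-const zero    c = refl
∑-const (suc m) c = begin
  c + ∑[ k < m ] c ≡⟨ cong (_+_ c) (∑-const m c) ⟩
  c + + m * c      ≡⟨ lemma c (+ m) ⟩
  (1ℤ + + m) * c   ∎
  where
  open ≡-Reasoning
  lemma : ∀ c m → c + m * c ≡ (1ℤ + m) * c
  lemma = solve-∀

∑-nonneg : ∀ m (f : Fin m → ℤ) → (∀ k → 0ℤ ≤ f k) → 0ℤ ≤ ∑[ k < m ] f k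
∑-nonneg zero    f p = ≤-refl
∑-nonneg (suc m) f p = +-mono-≤ (p zero) (∑-nonneg m (f ∘ suc) (p ∘ suc))

∑-first-two : ∀ {m} → 2 ℕ.≤ m → (f g : ℕ → ℤ) → g 0 + g 1 < f 0 + f 1 →
              (∀ k → 2 ℕ.≤ k → k ℕ.< m → g k ≡ f k) →
              ∑[ k < m ] g (toℕ k) < ∑[ k < m ] f (toℕ k)
∑-first-two {suc (suc m)} _ f g lt eq = begin-strict
  g 0 + (g 1 + G) ≡⟨ +-assoc (g 0) (g 1) G ⟨
  g 0 + g 1 + G   <⟨ +-monoˡ-< G lt ⟩
  f 0 + f 1 + G   ≡⟨ cong (_+_ (f 0 + f 1)) (sum-cong-≗ λ k → eq _ (s≤s (s≤s z≤n)) (s≤s (s≤s (toℕ<n k)))) ⟩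
  f 0 + f 1 + F   ≡⟨ +-assoc (f 0) (f 1) F ⟩
  f 0 + (f 1 + F) ∎
  where
  open ≤-Reasoning
  F = ∑[ k < m ] f (suc (suc (toℕ k)))
  G = ∑[ k < m ] g (suc (suc (toℕ k)))
∑-first-two {suc zero} (s≤s ()) _ _ _ _

square-nonneg : ∀ d → 0ℤ ≤ d * d
square-nonneg (+ m)    = subst (0ℤ ≤_) (pos-* m m) (+≤+ z≤n)
square-nonneg -[1+ m ] = +≤+ z≤n

no-negative-double : ∀ a → a ≡ - a → a ≡ 0ℤ
no-negative-double (+ zero)  _  = refl
no-negative-double (+ suc _) ()
no-negative-double -[1+ _ ]  ()

module AffineSymmetricGroup (n : ℕ) (2≤n : 2 ℕ.≤ n) where

  N : ℤ
  N = + n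

  instance
    n≢0 : ℕ.NonZero n
    n≢0 = ℕ.>-nonZero (ℕ.<-trans (s≤s z≤n) 2≤n)

  infix 4 _≡ₙ_ _≢ₙ_ _≡ₙ?_

  record _≡ₙ_ (i j : ℤ) : Set where
    constructor congruent
    field difference : + n ∣ i - j

  open _≡ₙ_

  _≢ₙ_ : ℤ → ℤ → Set
  i ≢ₙ j = ¬ (i ≡ₙ j)

  _≡ₙ?_ : ∀ i j → Dec (i ≡ₙ j)
  i ≡ₙ? j = Dec.map′ congruent difference (+ n ∣? i - j)

  ≡ₙ-refl : ∀ {i} → i ≡ₙ i
  ≡ₙ-refl {i} = congruent (divides 0ℤ (i≡j⇒i-j≡0 {i} refl))

  ≡ₙ-sym : ∀ {i j} → i ≡ₙ j → j ≡ₙ i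
  ≡ₙ-sym {i} {j} (congruent (divides q eq)) = congruent (divides (- q) (begin
    j - i       ≡⟨ l₁ i j ⟩
    - (i - j)   ≡⟨ cong -_ eq ⟩
    - (q * N)   ≡⟨ neg-distribˡ-* q N ⟩
    - q * N     ∎))
    where
    open ≡-Reasoning
    l₁ : ∀ i j → j - i ≡ - (i - j)
    l₁ = solve-∀

  ≡ₙ-trans : ∀ {i j k} → i ≡ₙ j → j ≡ₙ k → i ≡ₙ k
  ≡ₙ-trans {i} {j} {k} (congruent (divides q eq)) (congruent (divides p eq′)) = congruent (divides (q + p) (begin
    i - k               ≡⟨ l₁ i j k ⟩
    (i - j) + (j - k)   ≡⟨ cong₂ _+_ eq eq′ ⟩
    q * N + p * N       ≡⟨ *-distribʳ-+ N q p ⟨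
    (q + p) * N         ∎))
    where
    open ≡-Reasoning
    l₁ : ∀ i j k → i - k ≡ (i - j) + (j - k)
    l₁ = solve-∀

  ≡ₙ-shift : ∀ i → i + N ≡ₙ i
  ≡ₙ-shift i = congruent (divides 1ℤ (l₁ i N))
    where
    l₁ : ∀ i N → i + N - i ≡ 1ℤ * N
    l₁ = solve-∀

  ≡ₙ-translate : ∀ {i j} c → i ≡ₙ j → c + (i - j) ≡ₙ c
  ≡ₙ-translate {i} {j} c (congruent (divides q eq)) = congruent (divides q (trans (l₁ i j c) eq))
    where
    l₁ : ∀ i j c → c + (i - j) - c ≡ i - j
    l₁ = solve-∀

  small-≡ₙ : ∀ {a b} → a ℕ.< n → b ℕ.< n → + a ≡ₙ + b → a ≡ b
  small-≡ₙ {a} {b} a<n b<n d = +-injective (i-j≡0⇒i≡j (+ a) (+ b) (∣i∣≡0⇒i≡0 (zero-dist (∣⇒∣ᵤ (difference d)))))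
    where
    dist<n : ∣ + a - + b ∣ ℕ.< n
    dist<n = subst (λ z → ∣ z ∣ ℕ.< n) (sym (m-n≡m⊖n a b))
               (ℕ.≤-<-trans (∣m⊝n∣≤m⊔n a b) (ℕ.⊔-lub a<n b<n))
    zero-dist : n ℕ.∣ ∣ + a - + b ∣ → ∣ + a - + b ∣ ≡ 0
    zero-dist div with ∣ + a - + b ∣ | dist<n
    ... | zero  | _  = refl
    ... | suc c | lt = contradiction (ℕ.∣⇒≤ div) (ℕ.<⇒≱ lt)

  residue : ℤ → Fin n
  residue i = fromℕ< (n%ℕd<d i n)

  residue-≡ₙ : ∀ i → i ≡ₙ + toℕ (residue i)
  residue-≡ₙ i rewrite toℕ-fromℕ< (n%ℕd<d i n) = congruent (divides (i /ℕ n) (begin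
    i - + (i %ℕ n)                                    ≡⟨ cong (_- + (i %ℕ n)) (a≡a%ℕn+[a/ℕn]*n i n) ⟩
    + (i %ℕ n) + (i /ℕ n) * N - + (i %ℕ n)            ≡⟨ l₁ (+ (i %ℕ n)) ((i /ℕ n) * N) ⟩
    (i /ℕ n) * N                                      ∎))
    where
    open ≡-Reasoning
    l₁ : ∀ r q → r + q - r ≡ q
    l₁ = solve-∀

  residue-cong : ∀ {i j} → i ≡ₙ j → residue i ≡ residue j
  residue-cong {i} {j} i≡j = toℕ-injective (small-≡ₙ (toℕ<n (residue i)) (toℕ<n (residue j))
    (≡ₙ-trans (≡ₙ-sym (residue-≡ₙ i)) (≡ₙ-trans i≡j (residue-≡ₙ j))))

  residue-toℕ : ∀ k → residue (+ toℕ k) ≡ k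
  residue-toℕ k = toℕ-injective (small-≡ₙ (toℕ<n _) (toℕ<n k) (≡ₙ-sym (residue-≡ₙ (+ toℕ k))))

  Periodic : {A : Set} → (ℤ → A) → Set
  Periodic f = ∀ i → f (i + N) ≡ f i

  periodic-≡ₙ : {A : Set} {f : ℤ → A} → Periodic f → ∀ {i j} → i ≡ₙ j → f i ≡ f j
  periodic-≡ₙ {f = f} per {i} {j} (congruent (divides q eq)) = trans (cong f (l₀ eq)) (go q)
    where
    open ≡-Reasoning
    l₀ : i - j ≡ q * N → i ≡ j + q * N
    l₀ e = trans (l i j) (cong (_+_ j) e)
      where
      l : ∀ i j → i ≡ j + (i - j)
      l = solve-∀
    up : ∀ m → f (j + + m * N) ≡ f j
    up zero    = cong f (+-identityʳ j)
    up (suc m) = trans (cong f (l j (+ m) N)) (trans (per (j + + m * N)) (up m))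
      where
      l : ∀ j m N → j + (1ℤ + m) * N ≡ j + m * N + N
      l = solve-∀
    down : ∀ m → f (j + - (+ m) * N) ≡ f j
    down zero    = cong f (+-identityʳ j)
    down (suc m) = trans (sym (per _)) (trans (cong f (l j (+ m) N)) (down m))
      where
      l : ∀ j m N → j + - (1ℤ + m) * N + N ≡ j + - m * N
      l = solve-∀
    go : ∀ q → f (j + q * N) ≡ f j
    go (+ m)    = up m
    go -[1+ m ] = down (suc m)

  Equivariant : (ℤ → ℤ) → Set
  Equivariant g = ∀ i → g (i + N) ≡ g i + N

  displacement : (ℤ → ℤ) → ℤ → ℤ
  displacement g i = g i - i

  displacement-periodic : ∀ g → Equivariant g → Periodic (displacement g)
  displacement-periodic g eqv i = trans (cong (_- (i + N)) (eqv i)) (l (g i) i N)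
    where
    l : ∀ g i N → g + N - (i + N) ≡ g - i
    l = solve-∀

  residue-periodic : ∀ g → Equivariant g → Periodic (residue ∘ g)
  residue-periodic g eqv i = trans (cong residue (eqv i)) (residue-cong (≡ₙ-shift (g i)))

  from-equivariant : ∀ {g h : ℤ → ℤ} → (∀ i → g (h i) ≡ i) → (∀ i → h (g i) ≡ i) →
                     Equivariant g → Equivariant h
  from-equivariant {g} {h} gh hg eqv i = begin
    h (i + N)         ≡⟨ cong (λ j → h (j + N)) (gh i) ⟨
    h (g (h i) + N)   ≡⟨ cong h (eqv (h i)) ⟨
    h (g (h i + N))   ≡⟨ hg (h i + N) ⟩
    h i + N           ∎
    where open ≡-Reasoning

  permutation : (g h : ℤ → ℤ) → (∀ i → g (h i) ≡ i) → (∀ i → h (g i) ≡ i) →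
                Equivariant g → Permutation n n
  permutation g h gh hg eqv = Perm.permutation (λ k → residue (g (+ toℕ k))) (λ k → residue (h (+ toℕ k)))
    (λ k → half g h gh eqv k)
    (λ k → half h g hg (from-equivariant {g} {h} gh hg eqv) k)
    where
    half : (g h : ℤ → ℤ) → (∀ i → g (h i) ≡ i) → Equivariant g →
           ∀ k → residue (g (+ toℕ (residue (h (+ toℕ k))))) ≡ k
    half g h gh eqv k = begin
      residue (g (+ toℕ (residue (h (+ toℕ k))))) ≡⟨ periodic-≡ₙ (residue-periodic g eqv) (residue-≡ₙ (h (+ toℕ k))) ⟨
      residue (g (h (+ toℕ k)))                   ≡⟨ cong residue (gh _) ⟩
      residue (+ toℕ k)                           ≡⟨ residue-toℕ k ⟩
      k                                           ∎
      where open ≡-Reasoning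

  ∑-rearrange : ∀ {f : ℤ → ℤ} → Periodic f → (g h : ℤ → ℤ) →
                (∀ i → g (h i) ≡ i) → (∀ i → h (g i) ≡ i) → Equivariant g →
                ∑[ k < n ] f (g (+ toℕ k)) ≡ ∑[ k < n ] f (+ toℕ k)
  ∑-rearrange {f} per g h gh hg eqv = sym (trans
    (∑-permute (λ k → f (+ toℕ k)) (permutation g h gh hg eqv))
    (sum-cong-≗ {n} λ k → sym (periodic-≡ₙ per (residue-≡ₙ (g (+ toℕ k))))))

  ∑-window : ∀ {f : ℤ → ℤ} → Periodic f → ∀ c → ∑[ k < n ] f (c + + toℕ k) ≡ ∑[ k < n ] f (+ toℕ k)
  ∑-window per c = ∑-rearrange per (_+_ c) (_+_ (- c)) (l₁ c) (l₂ c) (λ i → sym (+-assoc c i N))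
    where
    l₁ : ∀ c i → c + (- c + i) ≡ i
    l₁ = solve-∀
    l₂ : ∀ c i → - c + (c + i) ≡ i
    l₂ = solve-∀

  balance : ∀ g → Equivariant g →
            ∑[ k < n ] g (+ suc (toℕ k)) ≡
            ∑[ k < n ] displacement g (+ toℕ k) + ∑[ k < n ] (+ suc (toℕ k))
  balance g eqv = begin
    ∑[ k < n ] g (+ suc (toℕ k))
      ≡⟨ sum-cong-≗ {n} (λ k → l (g (+ suc (toℕ k))) (+ suc (toℕ k))) ⟩
    ∑[ k < n ] (displacement g (1ℤ + + toℕ k) + + suc (toℕ k))
      ≡⟨ ∑-distrib-+ {n} (λ k → displacement g (1ℤ + + toℕ k)) (λ k → + suc (toℕ k)) ⟩
    ∑[ k < n ] displacement g (1ℤ + + toℕ k) + ∑[ k < n ] (+ suc (toℕ k))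
      ≡⟨ cong (_+ ∑[ k < n ] (+ suc (toℕ k))) (∑-window (displacement-periodic g eqv) 1ℤ) ⟩
    ∑[ k < n ] displacement g (+ toℕ k) + ∑[ k < n ] (+ suc (toℕ k)) ∎
    where
    open ≡-Reasoning
    l : ∀ g i → g ≡ g - i + i
    l = solve-∀

  balanced⇒∑≡0 : ∀ g → Equivariant g →
                 ∑[ k < n ] g (+ suc (toℕ k)) ≡ ∑[ k < n ] (+ suc (toℕ k)) →
                 ∑[ k < n ] displacement g (+ toℕ k) ≡ 0ℤ
  balanced⇒∑≡0 g eqv bal = +-cancelʳ _ _ 0ℤ (trans (sym (balance g eqv)) (trans bal (sym (+-identityˡ _))))
    where
    +-cancelʳ : ∀ z x y → x + z ≡ y + z → x ≡ y
    +-cancelʳ z x y e = trans (l x z) (trans (cong (_- z) e) (sym (l y z)))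
      where
      l : ∀ x z → x ≡ x + z - z
      l = solve-∀

  ∑≡0⇒balanced : ∀ g → Equivariant g → ∑[ k < n ] displacement g (+ toℕ k) ≡ 0ℤ →
                 ∑[ k < n ] g (+ suc (toℕ k)) ≡ ∑[ k < n ] (+ suc (toℕ k))
  ∑≡0⇒balanced g eqv z = trans (balance g eqv) (trans (cong (_+ _) z) (+-identityˡ _))

  -- The window is i = 1, …, n, with k : Fin n standing for i = k + 1.
  record S̃ : Set where
    field
      bijection : ℤ ↔ ℤ
    open Inverse bijection public using (to; from; strictlyInverseˡ; strictlyInverseʳ)
    field
      periodic : ∀ i → to (i + + n) ≡ to i + + n
      balanced : ∑[ k < n ] to (+ suc (toℕ k)) ≡ ∑[ k < n ] (+ suc (toℕ k))

  open S̃ public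

  infix 4 _≈_
  infixl 7 _∙_

  _≈_ : S̃ → S̃ → Set
  v ≈ w = ∀ i → to v i ≡ to w i

  to-injective : ∀ w {i j} → to w i ≡ to w j → i ≡ j
  to-injective w {i} {j} e = trans (sym (strictlyInverseʳ w i)) (trans (cong (from w) e) (strictlyInverseʳ w j))

  disp : S̃ → ℤ → ℤ
  disp w = displacement (to w)

  disp-periodic : ∀ w → Periodic (disp w)
  disp-periodic w = displacement-periodic (to w) (periodic w)

  ∑-disp : ∀ w → ∑[ k < n ] disp w (+ toℕ k) ≡ 0ℤ
  ∑-disp w = balanced⇒∑≡0 (to w) (periodic w) (balanced w)

  ∑-zero-half : ∀ {m} (f g h : Fin m → ℤ) → (∀ k → h k ≡ f k + g k) →
                ∑[ k < m ] f k ≡ 0ℤ → ∑[ k < m ] g k ≡ 0ℤ → ∑[ k < m ] h k ≡ 0ℤ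
  ∑-zero-half f g h e f0 g0 = trans (sum-cong-≗ e) (trans (∑-distrib-+ f g) (cong₂ _+_ f0 g0))

  +-disp : ∀ w i → to w i ≡ i + disp w i
  +-disp w i = l (to w i) i
    where
    l : ∀ g i → g ≡ i + (g - i)
    l = solve-∀

  ε : S̃
  ε = record
    { bijection = mk↔ₛ′ id id (λ _ → refl) (λ _ → refl)
    ; periodic  = λ _ → refl
    ; balanced  = refl
    }

  _∙_ : S̃ → S̃ → S̃
  v ∙ w = record
    { bijection = mk↔ₛ′ (to v ∘ to w) (from w ∘ from v)
        (λ i → trans (cong (to v) (strictlyInverseˡ w (from v i))) (strictlyInverseˡ v i))
        (λ i → trans (cong (from w) (strictlyInverseʳ v (to w i))) (strictlyInverseʳ w i))
    ; periodic  = eqv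
    ; balanced  = ∑≡0⇒balanced (to v ∘ to w) eqv (∑-zero-half {n} (λ k → disp v (to w (+ toℕ k))) (λ k → disp w (+ toℕ k)) (λ k → displacement (to v ∘ to w) (+ toℕ k))
        (λ k → l (to v (to w (+ toℕ k))) (to w (+ toℕ k)) (+ toℕ k))
        (trans (∑-rearrange (disp-periodic v) (to w) (from w) (strictlyInverseˡ w) (strictlyInverseʳ w) (periodic w))
               (∑-disp v))
        (∑-disp w))
    }
    where
    eqv : Equivariant (to v ∘ to w)
    eqv i = trans (cong (to v) (periodic w i)) (periodic v (to w i))
    l : ∀ a b c → a - c ≡ (a - b) + (b - c)
    l = solve-∀

  product : List S̃ → S̃
  product = foldr _∙_ ε

  S̃-decSetoid : DecSetoid 0ℓ 0ℓ
  S̃-decSetoid = record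
    { Carrier = S̃
    ; _≈_ = _≈_
    ; isDecEquivalence = record
      { isEquivalence = record
        { refl  = λ _ → refl
        ; sym   = λ p i → sym (p i)
        ; trans = λ p q i → trans (p i) (q i)
        }
      ; _≟_ = dec
      }
    }
    where
    dec : ∀ v w → Dec (v ≈ w)
    dec v w = Dec.map′ extend (λ p k → p _) (all? λ k → to v (+ toℕ k) ℤ.≟ to w (+ toℕ k))
      where
      extend : (∀ k → to v (+ toℕ k) ≡ to w (+ toℕ k)) → v ≈ w
      extend p i = begin
        to v i               ≡⟨ +-disp v i ⟩
        i + disp v i         ≡⟨ cong (_+_ i) (periodic-≡ₙ (disp-periodic v) (residue-≡ₙ i)) ⟩
        i + disp v r         ≡⟨ cong (λ z → i + (z - r)) (p (residue i)) ⟩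
        i + disp w r         ≡⟨ cong (_+_ i) (periodic-≡ₙ (disp-periodic w) (residue-≡ₙ i)) ⟨
        i + disp w i         ≡⟨ +-disp w i ⟨
        to w i               ∎
        where
        open ≡-Reasoning
        r = + toℕ (residue i)

  open DecSetoid S̃-decSetoid public using (_≟_) renaming (setoid to S̃-setoid)

  swap : ℤ → ℤ → ℤ → ℤ
  swap r s i =
    if does (i ≡ₙ? r) then s + (i - r) else
    if does (i ≡ₙ? s) then r + (i - s) else i

  if-yes : ∀ {A : Set} {P : Set} (P? : Dec P) {x y : A} → P → (if does P? then x else y) ≡ x
  if-yes P? {x} {y} p = cong (if_then x else y) (Dec.dec-true P? p)

  if-no : ∀ {A : Set} {P : Set} (P? : Dec P) {x y : A} → ¬ P → (if does P? then x else y) ≡ y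
  if-no P? {x} {y} ¬p = cong (if_then x else y) (Dec.dec-false P? ¬p)

  swap-r : ∀ r s {i} → i ≡ₙ r → swap r s i ≡ s + (i - r)
  swap-r r s {i} p = if-yes (i ≡ₙ? r) p

  swap-s : ∀ r s {i} → i ≢ₙ r → i ≡ₙ s → swap r s i ≡ r + (i - s)
  swap-s r s {i} ¬p q = trans (if-no (i ≡ₙ? r) ¬p) (if-yes (i ≡ₙ? s) q)

  swap-other : ∀ r s {i} → i ≢ₙ r → i ≢ₙ s → swap r s i ≡ i
  swap-other r s {i} ¬p ¬q = trans (if-no (i ≡ₙ? r) ¬p) (if-no (i ≡ₙ? s) ¬q)

  swap-involutive : ∀ r s → r ≢ₙ s → ∀ i → swap r s (swap r s i) ≡ i
  swap-involutive r s r≢s i = by-cases (i ≡ₙ? r) (i ≡ₙ? s)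
    where
    l : ∀ r s i → r + (s + (i - r) - s) ≡ i
    l = solve-∀
    by-cases : Dec (i ≡ₙ r) → Dec (i ≡ₙ s) → swap r s (swap r s i) ≡ i
    by-cases (yes p) _ = trans (cong (swap r s) (swap-r r s p))
      (trans (swap-s r s (λ e → r≢s (≡ₙ-trans (≡ₙ-sym e) (≡ₙ-translate s p))) (≡ₙ-translate s p)) (l r s i))
    by-cases (no ¬p) (yes q) = trans (cong (swap r s) (swap-s r s ¬p q))
      (trans (swap-r r s (≡ₙ-translate r q)) (l s r i))
    by-cases (no ¬p) (no ¬q) = trans (cong (swap r s) (swap-other r s ¬p ¬q)) (swap-other r s ¬p ¬q)

  swap-equivariant : ∀ r s → Equivariant (swap r s)
  swap-equivariant r s i = by-cases (i ≡ₙ? r) (i ≡ₙ? s)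
    where
    l : ∀ s r i N → s + (i + N - r) ≡ s + (i - r) + N
    l = solve-∀
    up : ∀ {j} → i ≡ₙ j → i + N ≡ₙ j
    up = ≡ₙ-trans (≡ₙ-shift i)
    down : ∀ {j} → i ≢ₙ j → i + N ≢ₙ j
    down ¬p = ¬p ∘ ≡ₙ-trans (≡ₙ-sym (≡ₙ-shift i))
    by-cases : Dec (i ≡ₙ r) → Dec (i ≡ₙ s) → swap r s (i + N) ≡ swap r s i + N
    by-cases (yes p) _ = trans (swap-r r s (up p)) (trans (l s r i N) (cong (_+ N) (sym (swap-r r s p))))
    by-cases (no ¬p) (yes q) = trans (swap-s r s (down ¬p) (up q))
      (trans (l r s i N) (cong (_+ N) (sym (swap-s r s ¬p q))))
    by-cases (no ¬p) (no ¬q) = trans (swap-other r s (down ¬p) (down ¬q))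
      (cong (_+ N) (sym (swap-other r s ¬p ¬q)))

  -- t-r, t-s, t-fixes and t-unique below characterise t r s.
  t : (r s : ℤ) → r ≢ₙ s → S̃
  t r s r≢s = record
    { bijection = mk↔ₛ′ (swap r s) (swap r s) inv inv
    ; periodic  = eqv
    ; balanced  = ∑≡0⇒balanced (swap r s) eqv (no-negative-double D (begin
        D                                                 ≡⟨ ∑-rearrange (displacement-periodic (swap r s) eqv) (swap r s) (swap r s) inv inv eqv ⟨
        ∑[ k < n ] displacement (swap r s) (swap r s (+ toℕ k))
          ≡⟨ sum-cong-≗ {n} (λ k → trans (cong (_- swap r s (+ toℕ k)) (inv (+ toℕ k))) (l (+ toℕ k) (swap r s (+ toℕ k)))) ⟩
        ∑[ k < n ] (- displacement (swap r s) (+ toℕ k))  ≡⟨ ∑-neg n (λ k → displacement (swap r s) (+ toℕ k)) ⟩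
        - D                                               ∎))
    }
    where
    open ≡-Reasoning
    inv = swap-involutive r s r≢s
    eqv = swap-equivariant r s
    D = ∑[ k < n ] displacement (swap r s) (+ toℕ k)
    l : ∀ i j → i - j ≡ - (j - i)
    l = solve-∀
    ∑-neg : ∀ m (f : Fin m → ℤ) → ∑[ k < m ] (- f k) ≡ - ∑[ k < m ] f k
    ∑-neg zero    f = refl
    ∑-neg (suc m) f = trans (cong (_+_ (- f zero)) (∑-neg m (f ∘ suc))) (sym (neg-distrib-+ (f zero) _))

  t-unique : ∀ r s (r≢s : r ≢ₙ s) (w : S̃) → to w r ≡ s → to w s ≡ r →
             (∀ i → i ≢ₙ r → i ≢ₙ s → to w i ≡ i) → w ≈ t r s r≢s
  t-unique r s r≢s w wr ws fix i = by-cases (i ≡ₙ? r) (i ≡ₙ? s)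
    where
    open ≡-Reasoning
    l : ∀ i s r → i + (s - r) ≡ s + (i - r)
    l = solve-∀
    moved : ∀ r s → to w r ≡ s → i ≡ₙ r → to w i ≡ s + (i - r)
    moved r s wr p = begin
      to w i          ≡⟨ +-disp w i ⟩
      i + disp w i    ≡⟨ cong (_+_ i) (periodic-≡ₙ (disp-periodic w) p) ⟩
      i + (to w r - r) ≡⟨ cong (λ z → i + (z - r)) wr ⟩
      i + (s - r)     ≡⟨ l i s r ⟩
      s + (i - r)     ∎
    by-cases : Dec (i ≡ₙ r) → Dec (i ≡ₙ s) → to w i ≡ swap r s i
    by-cases (yes p) _       = trans (moved r s wr p) (sym (swap-r r s p))
    by-cases (no ¬p) (yes q) = trans (moved s r ws q) (sym (swap-s r s ¬p q))
    by-cases (no ¬p) (no ¬q) = trans (fix i ¬p ¬q) (sym (swap-other r s ¬p ¬q))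

  t-r : ∀ r s (r≢s : r ≢ₙ s) → to (t r s r≢s) r ≡ s
  t-r r s _ = trans (swap-r r s ≡ₙ-refl) (trans (cong (_+_ s) (i≡j⇒i-j≡0 {r} refl)) (+-identityʳ s))

  t-s : ∀ r s (r≢s : r ≢ₙ s) → to (t r s r≢s) s ≡ r
  t-s r s r≢s = trans (swap-s r s (r≢s ∘ ≡ₙ-sym) ≡ₙ-refl) (trans (cong (_+_ r) (i≡j⇒i-j≡0 {s} refl)) (+-identityʳ r))

  t-fixes : ∀ r s (r≢s : r ≢ₙ s) i → i ≢ₙ r → i ≢ₙ s → to (t r s r≢s) i ≡ i
  t-fixes r s _ i = swap-other r s

  i≢ₙi+1 : ∀ i → i ≢ₙ i + 1ℤ
  i≢ₙi+1 i d = contradiction (small-≡ₙ 2≤n (ℕ.<-trans (s≤s z≤n) 2≤n) one≡zero) λ ()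
    where
    l : ∀ i → 1ℤ - 0ℤ ≡ i + 1ℤ - i
    l = solve-∀
    one≡zero : + 1 ≡ₙ + 0
    one≡zero = congruent (subst (+ n ∣_) (sym (l i)) (difference (≡ₙ-sym d)))

  s : Fin n → S̃
  s k = t (+ toℕ k) (+ toℕ k + 1ℤ) (i≢ₙi+1 (+ toℕ k))

  Word : Set
  Word = List (Fin n)

  eval : Word → S̃
  eval a = product (map s a)

  ∙-cong : ∀ {v v′ w w′} → v ≈ v′ → w ≈ w′ → v ∙ w ≈ v′ ∙ w′
  ∙-cong {v′ = v′} p q i = trans (p _) (cong (to v′) (q i))

  eval-snoc : ∀ a k → eval (a ++ k ∷ []) ≈ eval a ∙ s k
  eval-snoc []      k i = refl
  eval-snoc (l ∷ a) k i = cong (to (s l)) (eval-snoc a k i)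

  sq : ℤ → ℤ
  sq d = d * d

  energy : S̃ → ℤ
  energy w = ∑[ k < n ] sq (disp w (+ toℕ k))

  energy-nonneg : ∀ w → 0ℤ ≤ energy w
  energy-nonneg w = ∑-nonneg n _ (λ k → square-nonneg (disp w (+ toℕ k)))

  sq-periodic : ∀ w → Periodic (sq ∘ disp w)
  sq-periodic w i = cong sq (disp-periodic w i)

  pair-decreases : ∀ a b i → b < a →
                   sq (b - i) + sq (a - (i + 1ℤ)) < sq (a - i) + sq (b - (i + 1ℤ))
  pair-decreases a b i b<a = subst₂ _<_ (l₁ (a - i) (b - i) a i refl) (l₂ (a - i) (b - i) b i refl)
    (+-monoʳ-< (C (a - i) (b - i)) (*-monoˡ-<-pos (+ 2) (+-monoˡ-< (- i) b<a)))
    where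
    C : ℤ → ℤ → ℤ
    C A B = A * A + B * B + 1ℤ - + 2 * A - + 2 * B
    l : ∀ A B → A * A + B * B + 1ℤ - + 2 * A - + 2 * B + + 2 * B ≡ B * B + (A - 1ℤ) * (A - 1ℤ)
    l = solve-∀
    l′ : ∀ A B → A * A + B * B + 1ℤ - + 2 * A - + 2 * B + + 2 * A ≡ A * A + (B - 1ℤ) * (B - 1ℤ)
    l′ = solve-∀
    assoc- : ∀ a i → a - i - 1ℤ ≡ a - (i + 1ℤ)
    assoc- = solve-∀
    l₁ : ∀ A B a i → A ≡ a - i → C A B + + 2 * B ≡ B * B + sq (a - (i + 1ℤ))
    l₁ A B a i refl = trans (l A B) (cong (λ z → B * B + z * z) (assoc- a i))
    l₂ : ∀ A B b i → B ≡ b - i → C A B + + 2 * A ≡ A * A + sq (b - (i + 1ℤ))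
    l₂ A B b i refl = trans (l′ A B) (cong (λ z → A * A + z * z) (assoc- b i))

  descent : ∀ w k → to w (+ toℕ k + 1ℤ) < to w (+ toℕ k) → energy (w ∙ s k) < energy w
  descent w k lt = subst₂ _<_ (∑-window (sq-periodic (w ∙ s k)) i) (∑-window (sq-periodic w) i)
    (∑-first-two 2≤n f g g<f rest)
    where
    i = + toℕ k
    i≢ = i≢ₙi+1 i
    f g : ℕ → ℤ
    f j = sq (disp w (i + + j))
    g j = sq (disp (w ∙ s k) (i + + j))
    g0 : g 0 ≡ sq (to w (i + 1ℤ) - i)
    g0 = trans (cong (sq ∘ disp (w ∙ s k)) (+-identityʳ i))
               (cong (λ z → sq (to w z - i)) (t-r i (i + 1ℤ) i≢))
    g1 : g 1 ≡ sq (to w i - (i + 1ℤ))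
    g1 = cong (λ z → sq (to w z - (i + 1ℤ))) (t-s i (i + 1ℤ) i≢)
    f0 : f 0 ≡ sq (to w i - i)
    f0 = cong (sq ∘ disp w) (+-identityʳ i)
    g<f : g 0 + g 1 < f 0 + f 1
    g<f = subst₂ _<_ (sym (cong₂ _+_ g0 g1)) (cong (_+ f 1) (sym f0))
      (pair-decreases (to w i) (to w (i + 1ℤ)) i lt)
    offset : ∀ {a b} → i + a ≡ₙ i + b → a ≡ₙ b
    offset {a} {b} e = congruent (subst (+ n ∣_) (l i a b) (difference e))
      where
      l : ∀ i a b → i + a - (i + b) ≡ a - b
      l = solve-∀
    rest : ∀ j → 2 ℕ.≤ j → j ℕ.< n → g j ≡ f j
    rest j 2≤j j<n = cong (λ z → sq (to w z - (i + + j))) (t-fixes i (i + 1ℤ) i≢ (i + + j)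
      (λ e → ℕ.<⇒≢ (ℕ.<-trans (s≤s z≤n) 2≤j)
        (sym (small-≡ₙ j<n (ℕ.<-trans (s≤s z≤n) 2≤n) (offset (subst (i + + j ≡ₙ_) (sym (+-identityʳ i)) e)))))
      (λ e → ℕ.<⇒≢ 2≤j (sym (small-≡ₙ j<n 2≤n (offset e)))))

  ascending⇒ε : ∀ w → (∀ k → ¬ to w (+ toℕ k + 1ℤ) < to w (+ toℕ k)) → ε ≈ w
  ascending⇒ε w asc i = sym (trans (+-disp w i) (trans (cong (_+_ i) (disp≡0 i)) (+-identityʳ i)))
    where
    rise : ∀ j → disp w j ≤ disp w (j + 1ℤ)
    rise j = subst₂ _≤_ (sym (periodic-≡ₙ (disp-periodic w) (residue-≡ₙ j)))
      (sym (periodic-≡ₙ (disp-periodic w) (succ-cong (residue-≡ₙ j)))) (at (residue j))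
      where
      succ-cong : ∀ {i j} → i ≡ₙ j → i + 1ℤ ≡ₙ j + 1ℤ
      succ-cong {i} {j} e = congruent (subst (+ n ∣_) (l i j) (difference e))
        where
        l : ∀ i j → i - j ≡ i + 1ℤ - (j + 1ℤ)
        l = solve-∀
      at : ∀ k → disp w (+ toℕ k) ≤ disp w (+ toℕ k + 1ℤ)
      at k = subst₂ _≤_ (l₁ (to w i′) i′) (l₂ (to w (i′ + 1ℤ)) i′)
        (+-monoˡ-≤ (- (i′ + 1ℤ)) (i<j⇒suc[i]≤j (≤∧≢⇒< (≮⇒≥ (asc k)) ne)))
        where
        i′ = + toℕ k
        ne : to w i′ ≢ to w (i′ + 1ℤ)
        ne e = contradiction (trans (l i′) (trans (cong (_- i′) (sym (to-injective w e))) (+-inverseʳ i′))) λ ()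
          where
          l : ∀ i → 1ℤ ≡ i + 1ℤ - i
          l = solve-∀
        l₁ : ∀ a i → 1ℤ + a - (i + 1ℤ) ≡ a - i
        l₁ = solve-∀
        l₂ : ∀ b i → b - (i + 1ℤ) ≡ b - (i + 1ℤ)
        l₂ _ _ = refl
    rises : ∀ m j → disp w j ≤ disp w (j + + m)
    rises zero    j = ≤-reflexive (cong (disp w) (sym (+-identityʳ j)))
    rises (suc m) j = ≤-trans (rises m j) (subst (disp w (j + + m) ≤_) (cong (disp w) (l j (+ m))) (rise (j + + m)))
      where
      l : ∀ j m → j + m + 1ℤ ≡ j + (1ℤ + m)
      l = solve-∀
    constant : ∀ (k : Fin n) → disp w (+ toℕ k) ≡ disp w 0ℤ
    constant k = ≤-antisym
      (subst (disp w (+ toℕ k) ≤_)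
        (trans (cong (disp w) (trans (sym (pos-+ (toℕ k) (n ℕ.∸ toℕ k)))
                                     (trans (cong +_ (ℕ.m+[n∸m]≡n (ℕ.<⇒≤ (toℕ<n k)))) (sym (+-identityˡ N)))))
               (disp-periodic w 0ℤ))
        (rises (n ℕ.∸ toℕ k) (+ toℕ k)))
      (subst (disp w 0ℤ ≤_) (cong (disp w) (+-identityˡ (+ toℕ k))) (rises (toℕ k) 0ℤ))
    n*disp0≡0 : N * disp w 0ℤ ≡ 0ℤ
    n*disp0≡0 = begin
      N * disp w 0ℤ                  ≡⟨ ∑-const n (disp w 0ℤ) ⟨
      ∑[ k < n ] disp w 0ℤ           ≡⟨ sum-cong-≗ {n} {λ _ → disp w 0ℤ} {λ k → disp w (+ toℕ k)} (λ k → sym (constant k)) ⟩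
      ∑[ k < n ] disp w (+ toℕ k)    ≡⟨ ∑-disp w ⟩
      0ℤ                             ∎
      where open ≡-Reasoning
    disp0≡0 : disp w 0ℤ ≡ 0ℤ
    disp0≡0 = factor (i*j≡0⇒i≡0∨j≡0 N n*disp0≡0)
      where
      factor : N ≡ 0ℤ ⊎ disp w 0ℤ ≡ 0ℤ → disp w 0ℤ ≡ 0ℤ
      factor (inj₁ N≡0) = contradiction (+-injective N≡0) (ℕ.≢-nonZero⁻¹ n)
      factor (inj₂ e)   = e
    disp≡0 : ∀ i → disp w i ≡ 0ℤ
    disp≡0 i = trans (periodic-≡ₙ (disp-periodic w) (residue-≡ₙ i)) (trans (constant (residue i)) disp0≡0)

  energy-decreases : ∀ v w → energy v < energy w → ∣ energy v ∣ ℕ.< ∣ energy w ∣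
  energy-decreases v w lt = drop‿+<+ (subst₂ _<_
    (sym (0≤i⇒+∣i∣≡i (energy-nonneg v))) (sym (0≤i⇒+∣i∣≡i (energy-nonneg w))) lt)

  Descent : S̃ → Fin n → Set
  Descent w k = to w (+ toℕ k + 1ℤ) < to w (+ toℕ k)

  descent? : ∀ w → Decidable (Descent w)
  descent? w k = to w (+ toℕ k + 1ℤ) <? to w (+ toℕ k)

  append : ∀ w a k → eval a ≈ w ∙ s k → eval (a ++ k ∷ []) ≈ w
  append w a k eq i = begin
    to (eval (a ++ k ∷ [])) i     ≡⟨ eval-snoc a k i ⟩
    to (eval a) (to (s k) i)      ≡⟨ eq (to (s k) i) ⟩
    to w (to (s k) (to (s k) i))  ≡⟨ cong (to w) (strictlyInverseˡ (s k) i) ⟩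
    to w i                        ∎
    where open ≡-Reasoning

  generated : ∀ w → ∃ λ a → eval a ≈ w
  generated w = go (suc ∣ energy w ∣) w ℕ.≤-refl
    where
    go : ∀ m w → ∣ energy w ∣ ℕ.< m → ∃ λ a → eval a ≈ w
    go (suc m) w (s≤s bound) = by-cases (Fin.any? (descent? w))
      where
      extend : ∀ k → (∃ λ a → eval a ≈ w ∙ s k) → ∃ λ a → eval a ≈ w
      extend k (a , eq) = a ++ k ∷ [] , append w a k eq
      by-cases : Dec (∃ (Descent w)) → ∃ λ a → eval a ≈ w
      by-cases (no none)     = [] , ascending⇒ε w (λ k d → none (k , d))
      by-cases (yes (k , d)) = extend k (go m (w ∙ s k)
        (ℕ.<-≤-trans (energy-decreases (w ∙ s k) w (descent w k d)) bound))

  words : ℕ → List Word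
  words l = choices (replicate l (allFin n))

  ∈-words : ∀ a → a Mem.∈ words (length a)
  ∈-words []      = here refl
  ∈-words (k ∷ a) = Mem.∈-cartesianProductWith⁺ _∷_ (∈-allFin k) (∈-words a)

  length-words : ∀ l {a} → a Mem.∈ words l → length a ≡ l
  length-words zero    (here refl) = refl
  length-words (suc l) a∈ with Mem.∈-cartesianProductWith⁻ _∷_ (allFin n) (words l) a∈
  ... | _ , _ , _ , b∈ , refl = cong suc (length-words l b∈)

  any-word? : {P : Pred Word 0ℓ} → Decidable P → ∀ l → Dec (∃ λ a → length a ≡ l × P a)
  any-word? P? l = Dec.map′
    (λ p → let a , a∈ , Pa = find p in a , length-words l a∈ , Pa)
    (λ { (a , refl , Pa) → lose (∈-words a) Pa })
    (Any.any? P? (words l))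

  IsLength : S̃ → ℕ → Set
  IsLength w l = (∃ λ a → length a ≡ l × eval a ≈ w) × (∀ a → eval a ≈ w → l ℕ.≤ length a)

  abstract
    minimal-length : ∀ w → ∃ (IsLength w)
    minimal-length w =
      let a , eq = generated w
          l , found , min = least (any-word? λ a → eval a ≟ w) (length a) (a , refl , eq)
      in l , found , λ b e → min (length b) (b , refl , e)

  ℓ : S̃ → ℕ
  ℓ w = proj₁ (minimal-length w)

  ℓ-spec : ∀ w → IsLength w (ℓ w)
  ℓ-spec w = proj₂ (minimal-length w)

  ℓ-mono : ∀ {v w} → v ≈ w → ℓ v ℕ.≤ ℓ w
  ℓ-mono {v} {w} p =
    let (a , len , e) , _ = ℓ-spec w
    in subst (ℓ v ℕ.≤_) len (proj₂ (ℓ-spec v) a (λ i → trans (e i) (sym (p i))))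

  ℓ-cong : ∀ {v w} → v ≈ w → ℓ v ≡ ℓ w
  ℓ-cong {v} {w} p = ℕ.≤-antisym (ℓ-mono {v} {w} p) (ℓ-mono {w} {v} (sym ∘ p))

  values : ℕ → List S̃
  values l = map eval (words l)

  ∈-values : ∀ {l w} → ℓ w ≡ l → SMem._∈_ S̃-setoid w (values l)
  ∈-values {l} {w} ℓw≡l = locate (proj₁ (ℓ-spec w))
    where
    locate : (∃ λ a → length a ≡ ℓ w × eval a ≈ w) → SMem._∈_ S̃-setoid w (values l)
    locate (a , len , e) = Any.map⁺ (Any.map (λ {b} a≡b → subst (λ b → w ≈ eval b) a≡b (λ i → sym (e i)))
      (subst (λ l → a Mem.∈ words l) (trans len ℓw≡l) (∈-words a)))

  Reduced : Word → Set
  Reduced a = length a ≡ ℓ (eval a)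

  infix 4 _⋖_

  _⋖_ : S̃ → S̃ → Set
  v ⋖ w = (∃₂ λ r s → Σ (r ≢ₙ s) λ r≢s → w ≈ v ∙ t r s r≢s) × ℓ w ≡ suc (ℓ v)

  IsRightCover : ℤ → S̃ → S̃ → Set
  IsRightCover r v w = v ⋖ w × ∃ λ s → Σ (r ≢ₙ s) λ r≢s → r < s × w ≈ v ∙ t r s r≢s

  IsLeftCover : ℤ → S̃ → S̃ → Set
  IsLeftCover r v w = v ⋖ w × ∃ λ s → Σ (s ≢ₙ r) λ s≢r → s < r × w ≈ v ∙ t s r s≢r

  ⋖-resp : ∀ v → (v ⋖_) Respects _≈_
  ⋖-resp v {w} {w′} p ((r , s , r≢s , e) , len) =
    (r , s , r≢s , λ i → trans (sym (p i)) (e i)) , trans (ℓ-cong {w′} {w} (sym ∘ p)) len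

  right-resp : ∀ r v → IsRightCover r v Respects _≈_
  right-resp r v p (c , s , r≢s , lt , e) = ⋖-resp v p c , s , r≢s , lt , λ i → trans (sym (p i)) (e i)

  left-resp : ∀ r v → IsLeftCover r v Respects _≈_
  left-resp r v p (c , s , s≢r , lt , e) = ⋖-resp v p c , s , s≢r , lt , λ i → trans (sym (p i)) (e i)

  partner : ∀ v w r s → to w r ≡ to v s → from v (to w r) ≡ s
  partner v w r s e = trans (cong (from v) e) (strictlyInverseʳ v s)

  right? : ∀ r v → Decidable (IsRightCover r v)
  right? r v w with ℓ w ℕ.≟ suc (ℓ v) | r ≡ₙ? from v (to w r) | r <? from v (to w r)
  ... | no ¬len | _ | _ = no λ { ((_ , len) , _) → ¬len len }
  ... | yes _ | yes r≡s | _ = no λ { (_ , s , r≢s , _ , e) →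
          r≢s (subst (r ≡ₙ_) (partner v w r s (trans (e r) (cong (to v) (t-r r s r≢s)))) r≡s) }
  ... | yes _ | no _ | no r≮s = no λ { (_ , s , r≢s , r<s , e) →
          r≮s (subst (r <_) (sym (partner v w r s (trans (e r) (cong (to v) (t-r r s r≢s))))) r<s) }
  ... | yes len | no r≢s | yes r<s with w ≟ v ∙ t r (from v (to w r)) r≢s
  ...   | yes e = yes (((_ , _ , r≢s , e) , len) , _ , r≢s , r<s , e)
  ...   | no ¬e = no λ { (_ , s , r≢s′ , _ , e) →
            ¬e λ i → trans (e i) (cong (λ z → to v (swap r z i))
              (sym (partner v w r s (trans (e r) (cong (to v) (t-r r s r≢s′)))))) }

  left? : ∀ r v → Decidable (IsLeftCover r v)
  left? r v w with ℓ w ℕ.≟ suc (ℓ v) | from v (to w r) ≡ₙ? r | from v (to w r) <? r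
  ... | no ¬len | _ | _ = no λ { ((_ , len) , _) → ¬len len }
  ... | yes _ | yes s≡r | _ = no λ { (_ , s , s≢r , _ , e) →
          s≢r (subst (_≡ₙ r) (partner v w r s (trans (e r) (cong (to v) (t-s s r s≢r)))) s≡r) }
  ... | yes _ | no _ | no s≮r = no λ { (_ , s , s≢r , s<r , e) →
          s≮r (subst (_< r) (sym (partner v w r s (trans (e r) (cong (to v) (t-s s r s≢r))))) s<r) }
  ... | yes len | no s≢r | yes s<r with w ≟ v ∙ t (from v (to w r)) r s≢r
  ...   | yes e = yes (((_ , _ , s≢r , e) , len) , _ , s≢r , s<r , e)
  ...   | no ¬e = no λ { (_ , s , s≢r′ , _ , e) →
            ¬e λ i → trans (e i) (cong (λ z → to v (swap z r i))
              (sym (partner v w r s (trans (e r) (cong (to v) (t-s s r s≢r′)))))) }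

  Ψ⁺ : ∀ r v → Finite S̃-setoid (IsRightCover r v)
  Ψ⁺ r v = finite S̃-decSetoid (right? r v) (right-resp r v)
    (values (suc (ℓ v))) (λ { ((_ , len) , _) → ∈-values len })

  Ψ⁻ : ∀ r v → Finite S̃-setoid (IsLeftCover r v)
  Ψ⁻ r v = finite S̃-decSetoid (left? r v) (left-resp r v)
    (values (suc (ℓ v))) (λ { ((_ , len) , _) → ∈-values len })

  next : Fin n → Fin n
  next i = suc (toℕ i) mod n

  -- As the letters are distinct, each of i and i + 1 occurs at most once, so
  -- "i + 1 before i" is a comparison of positions.
  record CyclicallyDecreasingWord (a : Word) : Set where
    constructor cyclically-decreasing
    field
      reduced  : Reduced a
      distinct : Distinct a
      before   : ∀ p q → List.lookup a q ≡ next (List.lookup a p) → q Fin.< p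

  CyclicallyDecreasing : S̃ → Set
  CyclicallyDecreasing w = ∃ λ a → CyclicallyDecreasingWord a × eval a ≈ w

  IsDecomposition : List ℕ → S̃ → List S̃ → Set
  IsDecomposition α w ws =
    Pointwise (λ l u → CyclicallyDecreasing u × ℓ u ≡ l) α ws × w ≈ product ws

  cyclicallyDecreasingWord? : Decidable CyclicallyDecreasingWord
  cyclicallyDecreasingWord? a = Dec.map′
    (λ { (r , d , b) → cyclically-decreasing r d b })
    (λ { (cyclically-decreasing r d b) → r , d , b })
    (length a ℕ.≟ ℓ (eval a) ×-dec DecUnique.unique? (Fin._≟_ {n}) a ×-dec
     all? λ p → all? λ q → (List.lookup a q Fin.≟ next (List.lookup a p)) →-dec (q Fin.<? p))

  cyclicallyDecreasing? : Decidable CyclicallyDecreasing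
  cyclicallyDecreasing? w = Dec.map′
    (λ { (a , _ , p) → a , p })
    (λ { (a , p , e) → a , trans (CyclicallyDecreasingWord.reduced p) (ℓ-cong {eval a} {w} e) , p , e })
    (any-word? (λ a → cyclicallyDecreasingWord? a ×-dec (eval a ≟ w)) (ℓ w))

  tuple-decSetoid : DecSetoid 0ℓ 0ℓ
  tuple-decSetoid = Pointwise.decSetoid S̃-decSetoid

  tuple-setoid : Setoid 0ℓ 0ℓ
  tuple-setoid = Pointwise.setoid S̃-setoid

  product-cong : ∀ {us ws} → Pointwise _≈_ us ws → product us ≈ product ws
  product-cong []       = λ _ → refl
  product-cong (_∷_ {u} {w} {us} {ws} p ps) =
    ∙-cong {u} {w} {product us} {product ws} p (product-cong ps)

  decomposition-resp : ∀ α w → IsDecomposition α w Respects (Pointwise _≈_)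
  decomposition-resp α w ps (cds , e) =
    go cds ps , λ i → trans (e i) (product-cong ps i)
    where
    go : ∀ {α us ws} → Pointwise (λ l u → CyclicallyDecreasing u × ℓ u ≡ l) α us →
         Pointwise _≈_ us ws → Pointwise (λ l u → CyclicallyDecreasing u × ℓ u ≡ l) α ws
    go [] [] = []
    go (_∷_ {y = u} ((a , cd , e) , len) cds) (_∷_ {y = w} p ps) =
      ((a , cd , λ i → trans (e i) (p i)) , trans (ℓ-cong {w} {u} (sym ∘ p)) len) ∷ go cds ps

  decomposition? : ∀ α w → Decidable (IsDecomposition α w)
  decomposition? α w ws =
    Pointwise.decidable (λ l u → cyclicallyDecreasing? u ×-dec (ℓ u ℕ.≟ l)) α ws ×-dec (w ≟ product ws)

  candidates : List ℕ → List (List S̃)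
  candidates α = choices (map values α)

  ∈-candidates : ∀ {α ws} → Pointwise (λ l u → CyclicallyDecreasing u × ℓ u ≡ l) α ws →
                 SMem._∈_ tuple-setoid ws (candidates α)
  ∈-candidates [] = here []
  ∈-candidates ((_ , len) ∷ cds) = SMem.∈-cartesianProductWith⁺ S̃-setoid tuple-setoid tuple-setoid
    _∷_ (∈-values len) (∈-candidates cds)

  decompositions : ∀ α w → Finite tuple-setoid (IsDecomposition α w)
  decompositions α w = finite tuple-decSetoid (decomposition? α w) (decomposition-resp α w)
    (candidates α) (∈-candidates ∘ proj₁)

  -- Only the α that are compositions of ℓ(w) contribute: a tuple can multiply
  -- to w with ∑ αᵢ > ℓ(w), and such a tuple must not be counted.
  F̃ : S̃ → Series
  F̃ w α = if does (ℕ.sum α ℕ.≟ ℓ w) then card (decompositions α w) else 0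

{-# OPTIONS --safe #-}
-- In the nil Coxeter algebra, let ∂_r send A_w to the sum of A_v over all v that w covers as a right
-- r-cover, minus the same sum for left r-covers.  It is the correction term of A_w λ − (w λ) A_w in
-- the nil Hecke ring, so it satisfies the twisted Leibniz rule ∂_r(xy) = ∂_{y(r)}(x) y + x ∂_r(y), and
-- the claim is that ∂_r kills every product of the elements h_l = ∑ A_w, w cyclically decreasing of
-- length l.  By the Leibniz rule it suffices that ∂_r(h_l) = 0 for all r.  Cyclically decreasing
-- elements correspond to proper subsets of ℤ/n, and deleting a letter removes a point of the subset;
-- the coefficient of A_B in ∂_r(h_l) counts the points that can be added to B with sign +1 or −1, and
-- there is one of each if r − 1 ∉ B and none otherwise.
--
-- On words, ∂_r is a signed sum over the deletions of one letter.  For a fixed reflection t_{r,p} the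
-- signs of the letters at which the images of r and p are exchanged telescope, which shows that ∂_r
-- is compatible with the passage from words to A_w, non-reduced words included.
module Submission where

open import Defs
open import Level using (0ℓ)
open import Data.Bool.Base using (Bool; true; false; not; if_then_else_)
import Data.Bool.Properties as Bool
open import Data.Fin.Base as Fin using (Fin; zero; suc; toℕ)
import Data.Fin.Properties as Fin
open import Data.Integer.Base hiding (suc; _⊔_; _/_; _%_)
open import Data.Integer.Properties as ℤ hiding (_≟_; ≡-setoid; ≡-decSetoid)
open import Data.Integer.Divisibility.Signed using (_∣_; divides)
open import Data.Integer.Tactic.RingSolver using (solve-∀)
open import Data.List.Base as List using (List; []; _∷_; _++_; length; map; filter; concat; allFin; cartesianProductWith; applyDownFrom)
import Data.List.Properties as List
open import Data.List.Membership.Propositional as Mem using (_∈_; _∉_; find; lose)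
open import Data.List.Membership.Propositional.Properties as Mem using (∈-allFin; ∈-filter⁺; ∈-filter⁻)
import Data.List.Membership.Setoid as SMem
open import Data.List.Relation.Binary.Pointwise as Pointwise using (Pointwise; []; _∷_)
open import Data.List.Relation.Unary.All as All using (All; []; _∷_)
import Data.List.Relation.Unary.All.Properties as All
open import Data.List.Relation.Unary.AllPairs as AllPairs using (AllPairs; []; _∷_)
import Data.List.Relation.Unary.AllPairs.Properties as AllPairs
open import Data.List.Relation.Unary.Any as Any using (here; there)
import Data.List.Relation.Unary.Any.Properties as AnyP
open AnyP using (lookup-index)
import Data.List.Relation.Unary.Unique.Setoid as Unique
import Data.List.Relation.Unary.Unique.Setoid.Properties as Unique
open import Data.List.Relation.Unary.Unique.Propositional using () renaming (Unique to Distinct)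
import Data.List.Relation.Unary.Unique.Propositional.Properties as Distinct
open import Data.Nat as ℕ using (ℕ; zero; suc; z≤n; s≤s)
open import Data.Nat.DivMod using (_/_; _%_; _mod_; m%n<n; m≡m%n+[m/n]*n)
import Data.Nat.ListAction as ℕ
import Data.Nat.Properties as ℕ
open import Data.Product using (∃; _×_; _,_; proj₁; proj₂)
open import Data.Sum.Base using (_⊎_; inj₁; inj₂)
open import Data.Vec.Base using (Vec; []; _∷_; lookup; _[_]%=_; tabulate)
import Data.Vec.Properties as Vec
open import Function.Base using (_∘_; id; case_of_)
open import Relation.Binary.Bundles using (Setoid; DecSetoid)
import Relation.Binary.Construct.On as On
open import Relation.Binary.Definitions using (Tri; tri<; tri≈; tri>)
open import Relation.Binary.PropositionalEquality using (_≡_; _≢_; _≗_; refl; sym; trans; cong; cong₂; subst; subst₂; module ≡-Reasoning)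
open import Relation.Nullary using (¬_; Dec; yes; no; does; contradiction)
open import Relation.Nullary.Decidable as Dec using (dec-true; dec-false; _×-dec_)
open import Relation.Unary using (Pred; Decidable)

-- Indicators and integer sums over lists.

⟦_⟧ : {P : Set} → Dec P → ℤ
⟦ P? ⟧ = if does P? then 1ℤ else 0ℤ

⟦⟧-yes : {P : Set} (P? : Dec P) → P → ⟦ P? ⟧ ≡ 1ℤ
⟦⟧-yes P? p = cong (if_then 1ℤ else 0ℤ) (dec-true P? p)

⟦⟧-no : {P : Set} (P? : Dec P) → ¬ P → ⟦ P? ⟧ ≡ 0ℤ
⟦⟧-no P? ¬p = cong (if_then 1ℤ else 0ℤ) (dec-false P? ¬p)

⟦⟧-cong : {P Q : Set} (P? : Dec P) (Q? : Dec Q) → (P → Q) → (Q → P) → ⟦ P? ⟧ ≡ ⟦ Q? ⟧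
⟦⟧-cong (yes p) Q? f g = sym (⟦⟧-yes Q? (f p))
⟦⟧-cong (no ¬p) Q? f g = sym (⟦⟧-no Q? (¬p ∘ g))

sumOver : {A : Set} → List A → (A → ℤ) → ℤ
sumOver []       f = 0ℤ
sumOver (x ∷ xs) f = f x + sumOver xs f

infix 5 sumOver
syntax sumOver xs (λ x → e) = ∑[ x ← xs ] e

+-interchange : ∀ a b c d → (a + b) + (c + d) ≡ (a + c) + (b + d)
+-interchange = solve-∀

module _ {A : Set} where

  sum-cong-∈ : ∀ xs {f g : A → ℤ} → (∀ {x} → x ∈ xs → f x ≡ g x) → sumOver xs f ≡ sumOver xs g
  sum-cong-∈ []       e = refl
  sum-cong-∈ (x ∷ xs) e = cong₂ _+_ (e (here refl)) (sum-cong-∈ xs (e ∘ there))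

  sum-cong : ∀ xs {f g : A → ℤ} → f ≗ g → sumOver xs f ≡ sumOver xs g
  sum-cong xs e = sum-cong-∈ xs (λ {x} _ → e x)

  sum-zero : ∀ xs {f : A → ℤ} → (∀ {x} → x ∈ xs → f x ≡ 0ℤ) → sumOver xs f ≡ 0ℤ
  sum-zero []       e = refl
  sum-zero (x ∷ xs) e = cong₂ _+_ (e (here refl)) (sum-zero xs (e ∘ there))

  sum-+ : ∀ xs (f g : A → ℤ) → (∑[ x ← xs ] (f x + g x)) ≡ sumOver xs f + sumOver xs g
  sum-+ []       f g = refl
  sum-+ (x ∷ xs) f g = trans (cong (_+_ (f x + g x)) (sum-+ xs f g))
    (+-interchange (f x) (g x) (sumOver xs f) (sumOver xs g))

  sum-*ˡ : ∀ xs c (f : A → ℤ) → (∑[ x ← xs ] (c * f x)) ≡ c * sumOver xs f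
  sum-*ˡ []       c f = sym (*-zeroʳ c)
  sum-*ˡ (x ∷ xs) c f = trans (cong (_+_ (c * f x)) (sum-*ˡ xs c f)) (sym (*-distribˡ-+ c (f x) (sumOver xs f)))

  sum-neg : ∀ xs (f : A → ℤ) → (∑[ x ← xs ] (- f x)) ≡ - sumOver xs f
  sum-neg []       f = refl
  sum-neg (x ∷ xs) f = trans (cong (_+_ (- f x)) (sum-neg xs f)) (sym (neg-distrib-+ (f x) (sumOver xs f)))

  sum-- : ∀ xs (f g : A → ℤ) → (∑[ x ← xs ] (f x - g x)) ≡ sumOver xs f - sumOver xs g
  sum-- xs f g = trans (sum-+ xs f (-_ ∘ g)) (cong (_+_ (sumOver xs f)) (sum-neg xs g))

  sum-++ : ∀ xs ys (f : A → ℤ) → sumOver (xs ++ ys) f ≡ sumOver xs f + sumOver ys f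
  sum-++ []       ys f = sym (+-identityˡ _)
  sum-++ (x ∷ xs) ys f = trans (cong (_+_ (f x)) (sum-++ xs ys f)) (sym (+-assoc (f x) (sumOver xs f) (sumOver ys f)))

  sum-map : ∀ {B : Set} (g : B → A) ys (f : A → ℤ) → sumOver (map g ys) f ≡ sumOver ys (f ∘ g)
  sum-map g []       f = refl
  sum-map g (y ∷ ys) f = cong (_+_ (f (g y))) (sum-map g ys f)

  sum-filter : ∀ {P : Pred A 0ℓ} (P? : Decidable P) xs (f : A → ℤ) →
               sumOver (filter P? xs) f ≡ (∑[ x ← xs ] ⟦ P? x ⟧ * f x)
  sum-filter P? []       f = refl
  sum-filter P? (x ∷ xs) f with P? x
  ... | yes _ = cong₂ _+_ (sym (*-identityˡ (f x))) (sum-filter P? xs f)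
  ... | no _  = trans (sum-filter P? xs f) (sym (+-identityˡ _))

  sum-one : ∀ (xs : List A) → (∑[ x ← xs ] 1ℤ) ≡ + length xs
  sum-one []       = refl
  sum-one (x ∷ xs) = cong (_+_ 1ℤ) (sum-one xs)

  sum-ℕ : ∀ (xs : List A) (f : A → ℕ) → + ℕ.sum (map f xs) ≡ (∑[ x ← xs ] + f x)
  sum-ℕ []       f = refl
  sum-ℕ (x ∷ xs) f = trans (pos-+ (f x) _) (cong (_+_ (+ f x)) (sum-ℕ xs f))

sum-swap : ∀ {A B : Set} (xs : List A) (ys : List B) (f : A → B → ℤ) →
           (∑[ x ← xs ] ∑[ y ← ys ] f x y) ≡ (∑[ y ← ys ] ∑[ x ← xs ] f x y)
sum-swap []       ys f = sym (sum-zero ys (λ _ → refl))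
sum-swap (x ∷ xs) ys f = trans (cong (_+_ (sumOver ys (f x))) (sum-swap xs ys f))
  (sym (sum-+ ys (f x) (λ y → ∑[ x ← xs ] f x y)))

sum-cartesianProductWith : ∀ {A B C : Set} (g : A → B → C) xs ys (f : C → ℤ) →
  sumOver (cartesianProductWith g xs ys) f ≡ (∑[ x ← xs ] ∑[ y ← ys ] f (g x y))
sum-cartesianProductWith g []       ys f = refl
sum-cartesianProductWith g (x ∷ xs) ys f = trans (sum-++ (map (g x) ys) _ f)
  (cong₂ _+_ (sum-map (g x) ys f) (sum-cartesianProductWith g xs ys f))

-- Duplicate-free lists over a decidable setoid.

module _ (D : DecSetoid 0ℓ 0ℓ) where
  open DecSetoid D using (Carrier; _≈_; _≟_; setoid) renaming (sym to ≈-sym; trans to ≈-trans)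

  private
    _∈ₛ_ = SMem._∈_ setoid

  -- At most one entry of a duplicate-free list matches `x`. This replaces the enumeration inside a
  -- `Finite` set by the indicator of a decision procedure.
  count : ∀ {P : Pred Carrier 0ℓ} (P? : Decidable P) {xs} → Unique.Unique setoid xs → ∀ x →
          (P x → x ∈ₛ xs) → (x ∈ₛ xs → P x) → (∑[ y ← xs ] ⟦ x ≟ y ⟧) ≡ ⟦ P? x ⟧
  count P? {xs} u x complete sound = trans (go u) (⟦⟧-cong (Any.any? (x ≟_) xs) (P? x) sound complete)
    where
    go : ∀ {xs} → Unique.Unique setoid xs → (∑[ y ← xs ] ⟦ x ≟ y ⟧) ≡ ⟦ Any.any? (x ≟_) xs ⟧
    go {[]}     []       = refl
    go {y ∷ xs} (y∉ ∷ u) with x ≟ y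
    ... | yes x≈y = cong (_+_ 1ℤ) (trans (go u) (⟦⟧-no (Any.any? (x ≟_) xs)
          λ x∈ → All.All¬⇒¬Any y∉ (Any.map (≈-trans (≈-sym x≈y)) x∈)))
    ... | no _ = trans (+-identityˡ _) (go u)

  -- Multiply `f x` by `∑[ y ← ys ] ⟦ x ≟ y ⟧`, which is 1, swap the sums and collapse the one over
  -- `xs`. No bijection between the lists has to be constructed.
  sum-unique : ∀ {xs ys} → Unique.Unique setoid xs → Unique.Unique setoid ys →
               (∀ {x} → x ∈ₛ xs → x ∈ₛ ys) → (∀ {x} → x ∈ₛ ys → x ∈ₛ xs) →
               (f : Carrier → ℤ) → (∀ {x y} → x ≈ y → f x ≡ f y) →
               sumOver xs f ≡ sumOver ys f
  sum-unique {xs} {ys} ux uy ⊆ ⊇ f resp = begin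
    (∑[ x ← xs ] f x)
      ≡⟨ sum-cong-∈ xs (λ x∈ → sym (trans (cong (f _ *_) (hits ys uy (⊆ (Any.map (DecSetoid.reflexive D) x∈)))) (*-identityʳ _))) ⟩
    (∑[ x ← xs ] f x * (∑[ y ← ys ] ⟦ x ≟ y ⟧))
      ≡⟨ sum-cong xs (λ x → sym (sum-*ˡ ys (f x) _)) ⟩
    (∑[ x ← xs ] ∑[ y ← ys ] f x * ⟦ x ≟ y ⟧)
      ≡⟨ sum-swap xs ys _ ⟩
    (∑[ y ← ys ] ∑[ x ← xs ] f x * ⟦ x ≟ y ⟧)
      ≡⟨ sum-cong ys (λ y → sum-cong xs (λ x → exchange x y)) ⟩
    (∑[ y ← ys ] ∑[ x ← xs ] f y * ⟦ y ≟ x ⟧)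
      ≡⟨ sum-cong ys (λ y → sum-*ˡ xs (f y) _) ⟩
    (∑[ y ← ys ] f y * (∑[ x ← xs ] ⟦ y ≟ x ⟧))
      ≡⟨ sum-cong-∈ ys (λ y∈ → trans (cong (f _ *_) (hits xs ux (⊇ (Any.map (DecSetoid.reflexive D) y∈)))) (*-identityʳ _)) ⟩
    (∑[ y ← ys ] f y) ∎
    where
    open ≡-Reasoning
    hits : ∀ ys → Unique.Unique setoid ys → ∀ {x} → x ∈ₛ ys → (∑[ y ← ys ] ⟦ x ≟ y ⟧) ≡ 1ℤ
    hits ys u {x} x∈ = trans (count (λ x → Any.any? (x ≟_) ys) u x id id) (⟦⟧-yes (Any.any? (x ≟_) ys) x∈)
    exchange : ∀ x y → f x * ⟦ x ≟ y ⟧ ≡ f y * ⟦ y ≟ x ⟧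
    exchange x y with x ≟ y
    ... | yes p = cong₂ _*_ (resp p) (sym (⟦⟧-yes (y ≟ x) (≈-sym p)))
    ... | no ¬p = trans (*-zeroʳ (f x)) (sym (trans (cong (f y *_) (⟦⟧-no (y ≟ x) (¬p ∘ ≈-sym))) (*-zeroʳ (f y))))

  length-unique : ∀ {xs ys} → Unique.Unique setoid xs → Unique.Unique setoid ys →
                  (∀ {x} → x ∈ₛ xs → x ∈ₛ ys) → (∀ {x} → x ∈ₛ ys → x ∈ₛ xs) → length xs ≡ length ys
  length-unique {xs} {ys} ux uy ⊆ ⊇ = +-injective (trans (sym (sum-one xs))
    (trans (sum-unique ux uy ⊆ ⊇ (λ _ → 1ℤ) (λ _ → refl)) (sum-one ys)))

-- Cut `ys` at an occurrence of the head `x`: the tail of `xs` avoids `x`, so it still lies in the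
-- rest.
distinct-⊆-length : {A : Set} {xs ys : List A} → Distinct xs → (∀ {x} → x ∈ xs → x ∈ ys) →
                  length xs ℕ.≤ length ys
distinct-⊆-length {xs = []}     _         _ = z≤n
distinct-⊆-length {xs = x ∷ xs} (x∉ ∷ u) ⊆ with Mem.∈-∃++ (⊆ (here refl))
... | ys , zs , refl = ℕ.≤-trans (s≤s (distinct-⊆-length u avoid)) (ℕ.≤-reflexive (sym (begin
    length (ys ++ x ∷ zs)          ≡⟨ List.length-++ ys ⟩
    length ys ℕ.+ suc (length zs)  ≡⟨ ℕ.+-suc (length ys) (length zs) ⟩
    suc (length ys ℕ.+ length zs)  ≡⟨ cong suc (List.length-++ ys) ⟨
    suc (length (ys ++ zs))        ∎)))
  where
  open ≡-Reasoning
  avoid : ∀ {y} → y ∈ xs → y ∈ ys ++ zs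
  avoid {y} y∈ with Mem.∈-++⁻ ys (⊆ (there y∈))
  ... | inj₁ y∈ys         = Mem.∈-++⁺ˡ y∈ys
  ... | inj₂ (here y≡x)   = contradiction (sym y≡x) (All.lookup x∉ y∈)
  ... | inj₂ (there y∈zs) = Mem.∈-++⁺ʳ ys y∈zs

-- Sets of letters as characteristic vectors.

LetterSet : ℕ → Set
LetterSet = Vec Bool

infix 4 _∈?_

_∈?_ : ∀ {m} (k : Fin m) (A : LetterSet m) → Dec (lookup A k ≡ true)
k ∈? A = lookup A k Bool.≟ true

subsets : ∀ m → List (LetterSet m)
subsets zero    = [] ∷ []
subsets (suc m) = map (true ∷_) (subsets m) ++ map (false ∷_) (subsets m)

∈-subsets : ∀ {m} (A : LetterSet m) → A ∈ subsets m
∈-subsets []          = here refl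
∈-subsets (true ∷ A)  = Mem.∈-++⁺ˡ (Mem.∈-map⁺ (true ∷_) (∈-subsets A))
∈-subsets (false ∷ A) = Mem.∈-++⁺ʳ (map (true ∷_) (subsets _)) (Mem.∈-map⁺ (false ∷_) (∈-subsets A))

subsets-distinct : ∀ m → Distinct (subsets m)
subsets-distinct zero    = [] ∷ []
subsets-distinct (suc m) = Distinct.++⁺ (Distinct.map⁺ Vec.∷-injectiveʳ (subsets-distinct m))
  (Distinct.map⁺ Vec.∷-injectiveʳ (subsets-distinct m))
  λ { (p , q) → case Mem.∈-map⁻ (true ∷_) p of λ { (A , _ , refl) →
      case Mem.∈-map⁻ (false ∷_) q of λ { (_ , _ , ()) } } }

toggle : ∀ {m} → Fin m → LetterSet m → LetterSet m
toggle j A = A [ j ]%= not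

lookup-toggle : ∀ {m} (j : Fin m) A → lookup (toggle j A) j ≡ not (lookup A j)
lookup-toggle j A = Vec.lookup∘updateAt j A

lookup-toggle-≢ : ∀ {m} {j k : Fin m} A → k ≢ j → lookup (toggle j A) k ≡ lookup A k
lookup-toggle-≢ {j = j} {k} A k≢j = Vec.lookup∘updateAt′ k j k≢j A

toggle-involutive : ∀ {m} (j : Fin m) A → toggle j (toggle j A) ≡ A
toggle-involutive zero    (b ∷ A) = cong (_∷ A) (Bool.not-involutive b)
toggle-involutive (suc j) (b ∷ A) = cong (b ∷_) (toggle-involutive j A)

-- Toggling is an involution of the whole power set, so passing between a set with `j` and the same
-- set without it is an unconditional reindexing; conditions on membership stay in the summand.
sum-toggle : ∀ {m} (j : Fin m) (f : LetterSet m → ℤ) →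
             sumOver (subsets m) f ≡ sumOver (subsets m) (f ∘ toggle j)
sum-toggle {suc m} j f = trans (split f) (trans (flip j) (sym (split (f ∘ toggle j))))
  where
  split : ∀ (f : LetterSet (suc m) → ℤ) → sumOver (subsets (suc m)) f ≡
          sumOver (subsets m) (f ∘ (true ∷_)) + sumOver (subsets m) (f ∘ (false ∷_))
  split f = trans (sum-++ (map (true ∷_) (subsets m)) _ f)
    (cong₂ _+_ (sum-map (true ∷_) (subsets m) f) (sum-map (false ∷_) (subsets m) f))
  flip : ∀ j → sumOver (subsets m) (f ∘ (true ∷_)) + sumOver (subsets m) (f ∘ (false ∷_)) ≡
         sumOver (subsets m) (f ∘ toggle j ∘ (true ∷_)) + sumOver (subsets m) (f ∘ toggle j ∘ (false ∷_))
  flip zero    = +-comm (sumOver (subsets m) (f ∘ (true ∷_))) _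
  flip (suc j) = cong₂ _+_ (sum-toggle j (f ∘ (true ∷_))) (sum-toggle j (f ∘ (false ∷_)))

members : ∀ {m} → LetterSet m → List (Fin m)
members {m} A = filter (_∈? A) (allFin m)

∈-members⁺ : ∀ {m} {k : Fin m} {A} → lookup A k ≡ true → k ∈ members A
∈-members⁺ {A = A} = ∈-filter⁺ (_∈? A) (∈-allFin _)

∈-members⁻ : ∀ {m} {k : Fin m} {A} → k ∈ members A → lookup A k ≡ true
∈-members⁻ {m} {A = A} k∈ = proj₂ (∈-filter⁻ (_∈? A) {xs = allFin m} k∈)

members-distinct : ∀ {m} (A : LetterSet m) → Distinct (members A)
members-distinct {m} A = Distinct.filter⁺ (_∈? A) (Distinct.allFin⁺ m)

size : ∀ {m} → LetterSet m → ℕ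
size A = length (members A)

∉⇒size< : ∀ {m} {k : Fin m} {A} → lookup A k ≢ true → size A ℕ.< m
∉⇒size< {m} {k} {A} k∉ = subst (suc (size A) ℕ.≤_) (List.length-tabulate id)
  (distinct-⊆-length {xs = k ∷ members A} {allFin m}
    (All.¬Any⇒All¬ _ (k∉ ∘ ∈-members⁻ {A = A}) ∷ members-distinct A) (λ _ → ∈-allFin _))

size<⇒∉ : ∀ {m} (A : LetterSet m) → size A ℕ.< m → ∃ λ k → lookup A k ≢ true
size<⇒∉ {m} A lt with Fin.any? (λ k → Dec.¬? (k ∈? A))
... | yes found = found
... | no none = contradiction lt (ℕ.≤⇒≯ (subst (ℕ._≤ size A) (List.length-tabulate id)
  (distinct-⊆-length (Distinct.allFin⁺ m) λ {k} _ → ∈-members⁺ {A = A} (Dec.decidable-stable (k ∈? A) λ k∉ → none (k , k∉)))))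

size-toggle : ∀ {m} {j : Fin m} {A} → lookup A j ≢ true → size (toggle j A) ≡ suc (size A)
size-toggle {m} {j} {A} j∉ = length-unique (Fin.≡-decSetoid m) (members-distinct (toggle j A))
  (All.¬Any⇒All¬ _ (j∉ ∘ ∈-members⁻ {A = A}) ∷ members-distinct A) to from
  where
  to : ∀ {k} → k ∈ members (toggle j A) → k ∈ j ∷ members A
  to {k} k∈ with k Fin.≟ j
  ... | yes k≡j = here k≡j
  ... | no k≢j = there (∈-members⁺ {A = A} (trans (sym (lookup-toggle-≢ A k≢j)) (∈-members⁻ {A = toggle j A} k∈)))
  from : ∀ {k} → k ∈ j ∷ members A → k ∈ members (toggle j A)
  from (here refl) = ∈-members⁺ {A = toggle j A} (trans (lookup-toggle j A) (cong not (Bool.¬-not j∉)))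
  from {k} (there k∈) with k Fin.≟ j
  ... | yes refl = contradiction (∈-members⁻ {A = A} k∈) j∉
  ... | no k≢j = ∈-members⁺ {A = toggle j A} (trans (lookup-toggle-≢ A k≢j) (∈-members⁻ {A = A} k∈))

setOf : ∀ {m} → List (Fin m) → LetterSet m
setOf a = tabulate λ k → does (Any.any? (k Fin.≟_) a)

∈-setOf⁺ : ∀ {m} {k : Fin m} {a} → k ∈ a → lookup (setOf a) k ≡ true
∈-setOf⁺ {k = k} {a} k∈ = trans (Vec.lookup∘tabulate _ k) (dec-true (Any.any? (k Fin.≟_) a) k∈)

∈-setOf⁻ : ∀ {m} {k : Fin m} {a} → lookup (setOf a) k ≡ true → k ∈ a
∈-setOf⁻ {k = k} {a} e with Any.any? (k Fin.≟_) a | trans (sym (Vec.lookup∘tabulate (λ k → does (Any.any? (k Fin.≟_) a)) k)) e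
... | yes k∈ | _  = k∈
... | no _   | ()

lookup-ext : ∀ {m} {A B : LetterSet m} → (∀ k → lookup A k ≡ true → lookup B k ≡ true) →
             (∀ k → lookup B k ≡ true → lookup A k ≡ true) → A ≡ B
lookup-ext {A = A} {B} ⊆ ⊇ = trans (sym (Vec.tabulate∘lookup A)) (trans (Vec.tabulate-cong agree) (Vec.tabulate∘lookup B))
  where
  agree : lookup A ≗ lookup B
  agree k with lookup A k | lookup B k | ⊆ k | ⊇ k
  ... | true  | true  | _ | _ = refl
  ... | false | false | _ | _ = refl
  ... | true  | false | p | _ = sym (p refl)
  ... | false | true  | _ | q = q refl

module Transition (n : ℕ) (2≤n : 2 ℕ.≤ n) where
  open AffineSymmetricGroup n 2≤n

  -- Residues modulo n.

  residue-toℕ⁻ : ∀ {x k} → residue x ≡ k → x ≡ₙ + toℕ k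
  residue-toℕ⁻ {x} refl = residue-≡ₙ x

  residue-toℕ⁺ : ∀ {x k} → x ≡ₙ + toℕ k → residue x ≡ k
  residue-toℕ⁺ {k = k} e = trans (residue-cong e) (residue-toℕ k)

  ≡ₙ-+ : ∀ {x y} c → x ≡ₙ y → x + c ≡ₙ y + c
  ≡ₙ-+ {x} {y} c (congruent d) = congruent (subst (N ∣_) (l x y c) d)
    where
    l : ∀ x y c → x - y ≡ x + c - (y + c)
    l = solve-∀

  ≡ₙ-reflexive : ∀ {x y} → x ≡ y → x ≡ₙ y
  ≡ₙ-reflexive refl = ≡ₙ-refl

  m+1-1 : ∀ x → x + 1ℤ - 1ℤ ≡ x
  m+1-1 = solve-∀

  m-1+1 : ∀ x → x - 1ℤ + 1ℤ ≡ x
  m-1+1 = solve-∀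

  residue-pred⁺ : ∀ {x k} → x ≡ₙ + toℕ k + 1ℤ → residue (x - 1ℤ) ≡ k
  residue-pred⁺ {x} {k} e = residue-toℕ⁺ (≡ₙ-trans (≡ₙ-+ (- 1ℤ) e) (≡ₙ-reflexive (m+1-1 (+ toℕ k))))

  residue-pred⁻ : ∀ {x k} → residue (x - 1ℤ) ≡ k → x ≡ₙ + toℕ k + 1ℤ
  residue-pred⁻ {x} e = ≡ₙ-trans (≡ₙ-reflexive (sym (m-1+1 x))) (≡ₙ-+ 1ℤ (residue-toℕ⁻ {x - 1ℤ} e))

  residue-pred-≢ : ∀ x → residue x ≢ residue (x - 1ℤ)
  residue-pred-≢ x e = i≢ₙi+1 (x - 1ℤ) (≡ₙ-trans (residue-≡ₙ (x - 1ℤ))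
    (≡ₙ-trans (≡ₙ-reflexive (cong (+_ ∘ toℕ) (sym e)))
      (≡ₙ-trans (≡ₙ-sym (residue-≡ₙ x)) (≡ₙ-reflexive (sym (m-1+1 x))))))

  residue-suc : ∀ x → residue (x + 1ℤ) ≡ next (residue x)
  residue-suc x = residue-toℕ⁺ (≡ₙ-trans (≡ₙ-+ 1ℤ (residue-≡ₙ x)) (≡ₙ-trans
    (≡ₙ-reflexive (ℤ.+-comm (+ toℕ (residue x)) 1ℤ)) (mod-≡ₙ (suc (toℕ (residue x))))))
    where
    mod-≡ₙ : ∀ m → + m ≡ₙ + toℕ (m mod n)
    mod-≡ₙ m rewrite Fin.toℕ-fromℕ< (m%n<n m n) = congruent (divides (+ (m / n)) (begin
      + m - + (m % n)                           ≡⟨ cong (λ z → + z - + (m % n)) (m≡m%n+[m/n]*n m n) ⟩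
      + (m % n ℕ.+ m / n ℕ.* n) - + (m % n)     ≡⟨ cong (_- + (m % n)) (trans (pos-+ (m % n) _) (cong (_+_ (+ (m % n))) (pos-* (m / n) n))) ⟩
      + (m % n) + + (m / n) * N - + (m % n)     ≡⟨ l (+ (m % n)) (+ (m / n) * N) ⟩
      + (m / n) * N                             ∎))
      where
      open ≡-Reasoning
      l : ∀ a b → a + b - a ≡ b
      l = solve-∀

  residue-next : ∀ x → residue x ≡ next (residue (x - 1ℤ))
  residue-next x = trans (cong residue (sym (m-1+1 x))) (residue-suc (x - 1ℤ))

  -- Action of simple reflections and of words on the integers.

  data Action (k : Fin n) (x : ℤ) : ℤ → Set where
    up   : residue x ≡ k → Action k x (x + 1ℤ)
    down : residue (x - 1ℤ) ≡ k → Action k x (x - 1ℤ)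
    fix  : residue x ≢ k → residue (x - 1ℤ) ≢ k → Action k x x

  s-up : ∀ {k x} → residue x ≡ k → to (s k) x ≡ x + 1ℤ
  s-up {k} {x} e = trans (swap-r (+ toℕ k) (+ toℕ k + 1ℤ) (residue-toℕ⁻ e)) (l (+ toℕ k) x)
    where
    l : ∀ k x → k + 1ℤ + (x - k) ≡ x + 1ℤ
    l = solve-∀

  s-down : ∀ {k x} → residue (x - 1ℤ) ≡ k → to (s k) x ≡ x - 1ℤ
  s-down {k} {x} e = trans (swap-s (+ toℕ k) (+ toℕ k + 1ℤ)
    (λ d → residue-pred-≢ x (trans (residue-toℕ⁺ d) (sym e))) (residue-pred⁻ e)) (l (+ toℕ k) x)
    where
    l : ∀ k x → k + (x - (k + 1ℤ)) ≡ x - 1ℤ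
    l = solve-∀

  s-fix : ∀ {k x} → residue x ≢ k → residue (x - 1ℤ) ≢ k → to (s k) x ≡ x
  s-fix {k} ¬p ¬q = swap-other (+ toℕ k) (+ toℕ k + 1ℤ) (¬p ∘ residue-toℕ⁺) (¬q ∘ residue-pred⁺)

  -- The image is an index of `Action`, so matching on the result also specialises `to (s k) x` in
  -- the goal.
  action : ∀ k x → Action k x (to (s k) x)
  action k x with residue x Fin.≟ k
  ... | yes p = subst (Action k x) (sym (s-up p)) (up p)
  ... | no ¬p with residue (x - 1ℤ) Fin.≟ k
  ...   | yes q = subst (Action k x) (sym (s-down q)) (down q)
  ...   | no ¬q = subst (Action k x) (sym (s-fix ¬p ¬q)) (fix ¬p ¬q)

  eval-fixes : ∀ b {x} → residue x ∉ b → residue (x - 1ℤ) ∉ b → to (eval b) x ≡ x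
  eval-fixes []      _ _ = refl
  eval-fixes (k ∷ b) p q = trans (cong (to (s k)) (eval-fixes b (p ∘ there) (q ∘ there)))
    (s-fix (p ∘ here) (q ∘ here))

  i≤j∧i≢j⇒i≤j-1 : ∀ {i j} → i ≤ j → i ≢ j → i ≤ j - 1ℤ
  i≤j∧i≢j⇒i≤j-1 {i} {j} i≤j i≢j = i<j⇒i≤pred[j]′ (≤∧≢⇒< i≤j i≢j)
    where
    i<j⇒i≤pred[j]′ : i < j → i ≤ j - 1ℤ
    i<j⇒i≤pred[j]′ lt = subst₂ _≤_ (l i) (ℤ.+-comm (- 1ℤ) j) (+-monoʳ-≤ (- 1ℤ) (i<j⇒suc[i]≤j lt))
      where
      l : ∀ i → - 1ℤ + (1ℤ + i) ≡ i
      l = solve-∀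

  i<i+1 : ∀ i → i < i + 1ℤ
  i<i+1 i = subst (_< i + 1ℤ) (+-identityʳ i) (+-monoʳ-< i (+<+ (s≤s z≤n)))

  i-1<i : ∀ i → i - 1ℤ < i
  i-1<i i = subst (i - 1ℤ <_) (m-1+1 i) (i<i+1 (i - 1ℤ))

  i<j+1⇒i≤j : ∀ {i j} → i < j + 1ℤ → i ≤ j
  i<j+1⇒i≤j {i} {j} lt = subst (i ≤_) (m+1-1 j) (i≤j∧i≢j⇒i≤j-1 (<⇒≤ lt) (<⇒≢ lt))

  -- Without the letter k, no step of the word crosses between k and k + 1.
  eval-above : ∀ b {x y} → residue (x - 1ℤ) ∉ b → x ≤ y → x ≤ to (eval b) y
  eval-above []      _ x≤y = x≤y
  eval-above (k ∷ b) {x} {y} ∉ x≤y = step (action k (to (eval b) y)) (eval-above b (∉ ∘ there) x≤y)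
    where
    step : ∀ {i j} → Action k i j → x ≤ i → x ≤ j
    step (up _)   x≤i = ≤-trans x≤i (<⇒≤ (i<i+1 _))
    step (down e) x≤i = i≤j∧i≢j⇒i≤j-1 x≤i λ { refl → ∉ (here e) }
    step (fix _ _) x≤i = x≤i

  -- Cyclically decreasing words and the elements they evaluate to.

  Before : Fin n → Fin n → Set
  Before k l = l ≢ k × l ≢ next k

  -- Pairwise `Before` says that the letters are distinct and that `k + 1` never comes after `k`.
  -- Reducedness is recovered in `descending-length`.
  Descending : Word → Set
  Descending = AllPairs Before

  -- With `x` congruent to `k + 1`, only the letters `k` and `k + 1` move `x`, and neither stands to
  -- the right of `k`.
  tail-fixes : ∀ {k b x} → All (Before k) b → residue (x - 1ℤ) ≡ k → to (eval b) x ≡ x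
  tail-fixes {b = b} {x} av refl = eval-fixes b
    (λ x∈ → proj₂ (All.lookup av x∈) (residue-next x)) (λ x∈ → proj₁ (All.lookup av x∈) refl)

  -- The rightmost letters act first. Those after the letter `r - 1` fix `r`, that letter lowers it,
  -- and the letters before it can be neither `r - 1` nor `r - 2`, so they fix `r - 1`.
  descending-step : ∀ {a} → Descending a → ∀ {r} → residue (r - 1ℤ) ∈ a → to (eval a) r ≡ r - 1ℤ
  descending-step {k ∷ b} (av ∷ d) {r} (here e)   = trans (cong (to (s k)) (tail-fixes av e)) (s-down e)
  descending-step {k ∷ b} (av ∷ d) {r} (there r∈) = trans (cong (to (s k)) (descending-step d r∈))
    (s-fix (proj₁ (All.lookup av r∈)) λ e → proj₂ (All.lookup av r∈) (trans (residue-next (r - 1ℤ)) (cong next e)))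

  record RunEnd (a : Word) (r y : ℤ) : Set where
    field
      above  : r ≤ y
      absent : residue y ∉ a
      run    : ∀ z → r ≤ z → z < y → residue z ∈ a

  -- Since `k + 1` stands before `k`, the letters `r`, `r + 1`, ... act in this order, each raising
  -- the point by one, until a letter is missing.
  descending-run : ∀ {a} → Descending a → ∀ {r} → residue (r - 1ℤ) ∉ a → RunEnd a r (to (eval a) r)
  descending-run [] {r} ∉ = record { above = ≤-refl ; absent = λ () ; run = λ z r≤z z<r → contradiction z<r (≤⇒≯ r≤z) }
  descending-run {k ∷ b} (av ∷ d) {r} ∉ = step (action k (to (eval b) r)) refl (descending-run d (∉ ∘ there))
    where
    step : ∀ {x y} → Action k x y → to (eval b) r ≡ x → RunEnd b r x → RunEnd (k ∷ b) r y
    step {x} (up e) _ E = record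
      { above  = ≤-trans above (<⇒≤ (i<i+1 x))
      ; absent = λ { (here e′) → residue-pred-≢ (x + 1ℤ) (trans e′ (trans (sym e) (cong residue (sym (m+1-1 x)))))
                   ; (there x∈) → proj₂ (All.lookup av x∈) (trans (residue-suc x) (cong next e)) }
      ; run    = λ z r≤z z<x+1 → case z ℤ.≟ x of λ
          { (yes refl) → here e
          ; (no z≢x) → there (run z r≤z (≤∧≢⇒< (i<j+1⇒i≤j z<x+1) z≢x)) }
      }
      where open RunEnd E
    -- A step down would start from a point `x` that `b` fixes. By injectivity `x` is `r`, and then
    -- `k` is the letter `r - 1`, which is absent.
    step {x} (down e) r↦x E = contradiction (here (trans (cong (λ z → residue (z - 1ℤ)) r≡x) e)) ∉
      where
      r≡x : r ≡ x
      r≡x = to-injective (eval b) (trans r↦x (sym (tail-fixes av e)))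
    step (fix ¬e _) _ E = record
      { above  = above
      ; absent = λ { (here e) → ¬e e ; (there x∈) → absent x∈ }
      ; run    = λ z r≤z z<x → there (run z r≤z z<x)
      }
      where open RunEnd E

  run-end-unique : ∀ {a b r x y} → (∀ {k} → k ∈ a → k ∈ b) → (∀ {k} → k ∈ b → k ∈ a) →
                   RunEnd a r x → RunEnd b r y → x ≡ y
  run-end-unique {x = x} {y} a⊆b b⊆a X Y with <-cmp x y
  ... | tri< x<y _ _ = contradiction (b⊆a (RunEnd.run Y x (RunEnd.above X) x<y)) (RunEnd.absent X)
  ... | tri≈ _ e _   = e
  ... | tri> _ _ y<x = contradiction (a⊆b (RunEnd.run X y (RunEnd.above Y) y<x)) (RunEnd.absent Y)

  -- The values found in `descending-step` and `descending-run` refer to the word only through its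
  -- set of letters.
  eval-determined : ∀ {a b} → Descending a → Descending b → (∀ {k} → k ∈ a → k ∈ b) →
                    (∀ {k} → k ∈ b → k ∈ a) → eval a ≈ eval b
  eval-determined {a} {b} da db a⊆b b⊆a r = by-cases (Any.any? (residue (r - 1ℤ) Fin.≟_) a)
    where
    by-cases : Dec (residue (r - 1ℤ) ∈ a) → to (eval a) r ≡ to (eval b) r
    by-cases (yes r∈) = trans (descending-step da r∈) (sym (descending-step db (a⊆b r∈)))
    by-cases (no r∉)  = run-end-unique a⊆b b⊆a (descending-run da r∉) (descending-run db (r∉ ∘ b⊆a))

  -- `eval a` takes `k + 1` down to `k`; by `eval-above` no word without the letter `k` can do so.
  support : ∀ {a} b → Descending a → eval b ≈ eval a → ∀ {k} → k ∈ a → k ∈ b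
  support {a} b da e {k} k∈ = Dec.decidable-stable (Any.any? (k Fin.≟_) b) λ k∉ →
    <⇒≱ (i-1<i r) (subst (r ≤_) (trans (e r) (descending-step da (subst (_∈ a) (sym r-1) k∈)))
      (eval-above b (subst (_∉ b) (sym r-1) k∉) ≤-refl))
    where
    r = + toℕ k + 1ℤ
    r-1 : residue (r - 1ℤ) ≡ k
    r-1 = trans (cong residue (m+1-1 (+ toℕ k))) (residue-toℕ k)

  descending-distinct : ∀ {a} → Descending a → Distinct a
  descending-distinct = AllPairs.map λ (l≢k , _) k≡l → l≢k (sym k≡l)

  -- By `support` a shortest word for the same element contains all the letters of `a`, which are
  -- distinct.
  descending-length : ∀ {a} → Descending a → ℓ (eval a) ≡ length a
  descending-length {a} d = let (b , len , e) , min = ℓ-spec (eval a) in ℕ.≤-antisym (min a (λ _ → refl))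
    (ℕ.≤-trans (distinct-⊆-length (descending-distinct d) (support b d e)) (ℕ.≤-reflexive len))

  next-≢ : ∀ k → next k ≢ k
  next-≢ k e = residue-pred-≢ (+ toℕ k + 1ℤ) (begin
    residue (+ toℕ k + 1ℤ)         ≡⟨ residue-suc (+ toℕ k) ⟩
    next (residue (+ toℕ k))       ≡⟨ cong next (residue-toℕ k) ⟩
    next k                         ≡⟨ e ⟩
    k                              ≡⟨ residue-toℕ k ⟨
    residue (+ toℕ k)              ≡⟨ cong residue (m+1-1 (+ toℕ k)) ⟨
    residue (+ toℕ k + 1ℤ - 1ℤ)    ∎)
    where open ≡-Reasoning

  descending⇒cyclic : ∀ {a} → Descending a → CyclicallyDecreasingWord a
  descending⇒cyclic d = cyclically-decreasing (sym (descending-length d)) (descending-distinct d) (before d)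
    where
    before : ∀ {a} → Descending a → ∀ p q → List.lookup a q ≡ next (List.lookup a p) → q Fin.< p
    before (av ∷ d) zero    zero    e = contradiction (sym e) (next-≢ _)
    before (av ∷ d) zero    (suc q) e = contradiction e (proj₂ (All.lookup av (Mem.∈-lookup q)))
    before (av ∷ d) (suc p) zero    e = s≤s z≤n
    before (av ∷ d) (suc p) (suc q) e = s≤s (before d p q e)

  cyclic⇒descending : ∀ {a} → CyclicallyDecreasingWord a → Descending a
  cyclic⇒descending (cyclically-decreasing _ u b) = go u b
    where
    go : ∀ {a} → Distinct a → (∀ p q → List.lookup a q ≡ next (List.lookup a p) → q Fin.< p) → Descending a
    go []        _ = []
    go (k∉ ∷ u) b = All.tabulate (λ l∈ →
        (λ { refl → All.lookup k∉ l∈ refl }) ,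
        (λ l≡ → case b zero (suc (Any.index l∈)) (trans (sym (lookup-index l∈)) l≡) of λ ()))
      ∷ go u (λ p q e → ℕ.s≤s⁻¹ (b (suc p) (suc q) e))

  -- The successor of the first letter could only stand before it. Hence the letters of a descending
  -- word form a proper subset of ℤ/n.
  descending-next∉ : ∀ {k a} → Descending (k ∷ a) → next k ∉ k ∷ a
  descending-next∉ {k} (av ∷ _) (here e)   = next-≢ k e
  descending-next∉     (av ∷ _) (there k∈) = proj₂ (All.lookup av k∈) refl

  -- The operator ∂ on words.

  crossing : Fin n → ℤ → ℤ
  crossing k x = ⟦ residue x Fin.≟ k ⟧ - ⟦ residue (x - 1ℤ) Fin.≟ k ⟧

  crossing-up : ∀ {k x} → residue x ≡ k → crossing k x ≡ 1ℤ
  crossing-up {k} {x} e = cong₂ _-_ (⟦⟧-yes (residue x Fin.≟ k) e)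
    (⟦⟧-no (residue (x - 1ℤ) Fin.≟ k) λ e′ → residue-pred-≢ x (trans e (sym e′)))

  crossing-down : ∀ {k x} → residue (x - 1ℤ) ≡ k → crossing k x ≡ - 1ℤ
  crossing-down {k} {x} e = cong₂ _-_ (⟦⟧-no (residue x Fin.≟ k) λ e′ → residue-pred-≢ x (trans e′ (sym e)))
    (⟦⟧-yes (residue (x - 1ℤ) Fin.≟ k) e)

  crossing-fix : ∀ {k x} → residue x ≢ k → residue (x - 1ℤ) ≢ k → crossing k x ≡ 0ℤ
  crossing-fix {k} {x} ¬p ¬q = cong₂ _-_ (⟦⟧-no (residue x Fin.≟ k) ¬p) (⟦⟧-no (residue (x - 1ℤ) Fin.≟ k) ¬q)

  -- A formal sum of words is represented by its pairing with a test function `f`. The sign of a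
  -- deleted letter `k` is the displacement under `s k` of the image of `r` under the suffix after
  -- it.
  ∂ : ℤ → Word → (Word → ℤ) → ℤ
  ∂ r []      f = 0ℤ
  ∂ r (k ∷ b) f = crossing k (to (eval b) r) * f b + ∂ r b (f ∘ (k ∷_))

  ∂-cong : ∀ r b {f g} → f ≗ g → ∂ r b f ≡ ∂ r b g
  ∂-cong r []      e = refl
  ∂-cong r (k ∷ b) e = cong₂ _+_ (cong (crossing k (to (eval b) r) *_) (e b)) (∂-cong r b (e ∘ (k ∷_)))

  eval-++ : ∀ a b i → to (eval (a ++ b)) i ≡ to (eval a) (to (eval b) i)
  eval-++ []      b i = refl
  eval-++ (k ∷ a) b i = cong (to (s k)) (eval-++ a b i)

  -- The twisted Leibniz rule: the letters of `a` see `r` only after `b` has moved it.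
  ∂-++ : ∀ r a b f → ∂ r (a ++ b) f ≡ ∂ (to (eval b) r) a (λ g → f (g ++ b)) + ∂ r b (λ g → f (a ++ g))
  ∂-++ r []      b f = sym (+-identityˡ _)
  ∂-++ r (k ∷ a) b f = trans
    (cong₂ _+_ (cong (λ x → crossing k x * f (a ++ b)) (eval-++ a b r)) (∂-++ r a b (f ∘ (k ∷_))))
    (sym (+-assoc (crossing k (to (eval a) (to (eval b) r)) * f (a ++ b))
                  (∂ (to (eval b) r) a (λ g → f (k ∷ g ++ b))) (∂ r b (λ g → f (k ∷ a ++ g)))))

  -- Reflections and the exchange condition.

  s-involutive : ∀ k x → to (s k) (to (s k) x) ≡ x
  s-involutive k = strictlyInverseˡ (s k)

  to-≡ₙ : ∀ w {i j} → i ≡ₙ j → to w i ≡ to w j + (i - j)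
  to-≡ₙ w {i} {j} e = trans (+-disp w i) (trans (cong (_+_ i) (periodic-≡ₙ (disp-periodic w) e)) (l i j (to w j)))
    where
    l : ∀ i j y → i + (y - j) ≡ y + (i - j)
    l = solve-∀

  to-≡ₙ⁻ : ∀ w {i j} → to w i ≡ₙ to w j → i ≡ₙ j
  to-≡ₙ⁻ w {i} {j} e = subst (_≡ₙ j) (to-injective w (begin
    to w (j + d)            ≡⟨ to-≡ₙ w (≡ₙ-translate j e) ⟩
    to w j + (j + d - j)    ≡⟨ l (to w j) (to w i) j ⟩
    to w i                  ∎)) (≡ₙ-translate j e)
    where
    open ≡-Reasoning
    d = to w i - to w j
    l : ∀ y x j → y + (j + (x - y) - j) ≡ x
    l = solve-∀

  data Moves (k : Fin n) (x : ℤ) : Set where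
    up   : residue x ≡ k → Moves k x
    down : residue (x - 1ℤ) ≡ k → Moves k x

  moves-≢ : ∀ {k x} → Moves k x → x ≢ₙ to (s k) x
  moves-≢ {k} {x} (up e) d = i≢ₙi+1 x (≡ₙ-trans d (≡ₙ-reflexive (s-up e)))
  moves-≢ {k} {x} (down e) d = i≢ₙi+1 (x - 1ℤ)
    (≡ₙ-trans (≡ₙ-reflexive (sym (s-down {k} {x} e))) (≡ₙ-trans (≡ₙ-sym {x} d) (≡ₙ-reflexive (sym (m-1+1 x)))))

  moves? : ∀ k x → Moves k x ⊎ (residue x ≢ k × residue (x - 1ℤ) ≢ k)
  moves? k x = by-cases (residue x Fin.≟ k) (residue (x - 1ℤ) Fin.≟ k)
    where
    by-cases : Dec (residue x ≡ k) → Dec (residue (x - 1ℤ) ≡ k) → Moves k x ⊎ (residue x ≢ k × residue (x - 1ℤ) ≢ k)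
    by-cases (yes p) _        = inj₁ (up p)
    by-cases (no ¬p) (yes q)  = inj₁ (down q)
    by-cases (no ¬p) (no ¬q)  = inj₂ (¬p , ¬q)

  moves-others : ∀ {k x} → Moves k x → ∀ {y} → y ≢ₙ x → y ≢ₙ to (s k) x → to (s k) y ≡ y
  moves-others {k} {x} (up e) {y} y≢x y≢x′ = s-fix
    (λ e′ → y≢x (≡ₙ-trans (residue-toℕ⁻ e′) (≡ₙ-sym (residue-toℕ⁻ e))))
    (λ e′ → y≢x′ (≡ₙ-trans (residue-pred⁻ {y} e′) (≡ₙ-trans (≡ₙ-+ 1ℤ (≡ₙ-sym (residue-toℕ⁻ {x} e))) (≡ₙ-reflexive (sym (s-up {k} {x} e))))))
  moves-others {k} {x} (down e) {y} y≢x y≢x′ = s-fix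
    (λ e′ → y≢x′ (≡ₙ-trans (residue-toℕ⁻ e′) (≡ₙ-trans (≡ₙ-sym (residue-toℕ⁻ {x - 1ℤ} e)) (≡ₙ-reflexive (sym (s-down {k} {x} e))))))
    (λ e′ → y≢x (≡ₙ-trans (residue-pred⁻ {y} e′) (≡ₙ-sym (residue-pred⁻ {x} e))))

  -- The conjugation `w = s_k w t_{r,p}`: `s k` exchanges the values of `w` at `r` and `p`, together
  -- with their translates by multiples of `n`, and fixes all other values.
  reflect : ∀ w k r p → Moves k (to w r) → to w p ≡ to (s k) (to w r) →
            ∀ i → to w i ≡ to (s k) (to w (swap r p i))
  reflect w k r p m e i = by-cases (i ≡ₙ? r) (i ≡ₙ? p)
    where
    open ≡-Reasoning
    e′ : to w r ≡ to (s k) (to w p)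
    e′ = sym (trans (cong (to (s k)) e) (s-involutive k (to w r)))
    -- `i - a` is a multiple of `n`, and both `w` and `s k` commute with translation by it.
    moved : ∀ a b → to w a ≡ to (s k) (to w b) → i ≡ₙ a → to w i ≡ to (s k) (to w (b + (i - a)))
    moved a b e d = begin
      to w i                                          ≡⟨ to-≡ₙ w d ⟩
      to w a + (i - a)                                ≡⟨ cong (_+ (i - a)) e ⟩
      to (s k) (to w b) + (i - a)                     ≡⟨ cong (_+_ (to (s k) (to w b))) (l (to w b) (i - a)) ⟨
      to (s k) (to w b) + (to w b + (i - a) - to w b) ≡⟨ to-≡ₙ (s k) (≡ₙ-translate (to w b) d) ⟨
      to (s k) (to w b + (i - a))                     ≡⟨ cong (λ z → to (s k) (to w b + z)) (l b (i - a)) ⟨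
      to (s k) (to w b + (b + (i - a) - b))           ≡⟨ cong (to (s k)) (to-≡ₙ w (≡ₙ-translate b d)) ⟨
      to (s k) (to w (b + (i - a)))                   ∎
      where
      l : ∀ b c → b + c - b ≡ c
      l = solve-∀
    by-cases : Dec (i ≡ₙ r) → Dec (i ≡ₙ p) → to w i ≡ to (s k) (to w (swap r p i))
    by-cases (yes d) _       = trans (moved r p e′ d) (cong (to (s k) ∘ to w) (sym (swap-r r p d)))
    by-cases (no ¬d) (yes d) = trans (moved p r e d) (cong (to (s k) ∘ to w) (sym (swap-s r p ¬d d)))
    by-cases (no ¬d) (no ¬c) = sym (trans (cong (to (s k) ∘ to w) (swap-other r p ¬d ¬c))
      (moves-others m (¬d ∘ to-≡ₙ⁻ w) (λ c → ¬c (to-≡ₙ⁻ w (≡ₙ-trans c (≡ₙ-reflexive (sym e)))))))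

  s-upper : ∀ k y → y - 1ℤ ≤ to (s k) y
  s-upper k y = bound (action k y)
    where
    bound : ∀ {z} → Action k y z → y - 1ℤ ≤ z
    bound (up _)    = <⇒≤ (<-trans (i-1<i y) (i<i+1 y))
    bound (down _)  = ≤-refl
    bound (fix _ _) = <⇒≤ (i-1<i y)

  -- A simple reflection reverses only the pairs that it exchanges: for the others, `y - 1` lies
  -- weakly between the two images.
  s-monotone : ∀ k {x y} → x < y → y ≢ to (s k) x → to (s k) x < to (s k) y
  s-monotone k {x} {y} x<y y≢ = ≤∧≢⇒< (≤-trans (bound (action k x) y≢) (s-upper k y))
    (<⇒≢ x<y ∘ to-injective (s k))
    where
    bound : ∀ {z} → Action k x z → y ≢ z → z ≤ y - 1ℤ
    bound (up _) y≢x+1 = i≤j∧i≢j⇒i≤j-1 (subst (_≤ y) (ℤ.+-comm 1ℤ x) (i<j⇒suc[i]≤j x<y)) (y≢x+1 ∘ sym)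
    bound (down _) _   = +-monoˡ-≤ (- 1ℤ) (<⇒≤ x<y)
    bound (fix _ _) _  = i≤j∧i≢j⇒i≤j-1 (<⇒≤ x<y) (<⇒≢ x<y)

  ≮∧≢⇒> : ∀ {i j} → ¬ i < j → i ≢ j → j < i
  ≮∧≢⇒> i≮j i≢j = ≤∧≢⇒< (≮⇒≥ i≮j) (i≢j ∘ sym)

  ≢ₙ⇒≢ : ∀ {i j} → i ≢ₙ j → i ≢ j
  ≢ₙ⇒≢ i≢j refl = i≢j ≡ₙ-refl

  -- The strong exchange condition. The images of `r < p` start in order and end inverted, so some
  -- letter reverses them. By `s-monotone` that letter exchanges them, and by `reflect` its deletion
  -- amounts to multiplying by `t_{r,p}` on the right.
  exchange : ∀ b r p → r ≢ₙ p → r < p → to (eval b) p < to (eval b) r →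
             ∃ λ b′ → length b ≡ suc (length b′) × (∀ i → to (eval b′) i ≡ to (eval b) (swap r p i))
  exchange [] r p _ r<p p<r = contradiction p<r (<-asym r<p)
  exchange (k ∷ b) r p r≢p r<p inv = by-cases (to (eval b) p <? to (eval b) r) (to (eval b) p ℤ.≟ to (s k) (to (eval b) r))
    where
    by-cases : Dec (to (eval b) p < to (eval b) r) → Dec (to (eval b) p ≡ to (s k) (to (eval b) r)) →
               ∃ λ b′ → suc (length b) ≡ suc (length b′) × (∀ i → to (eval b′) i ≡ to (eval (k ∷ b)) (swap r p i))
    by-cases (yes lt) _ = let b′ , len , e = exchange b r p r≢p r<p lt in
      k ∷ b′ , cong suc len , λ i → cong (to (s k)) (e i)
    by-cases (no ¬lt) (yes e) = b , refl , moved (moves? k (to (eval b) r))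
      where
      moved : Moves k (to (eval b) r) ⊎ _ → ∀ i → to (eval b) i ≡ to (eval (k ∷ b)) (swap r p i)
      moved (inj₁ m) = reflect (eval b) k r p m e
      moved (inj₂ (¬u , ¬d)) = contradiction (to-injective (eval b) (sym (trans e (s-fix ¬u ¬d)))) (≢ₙ⇒≢ r≢p)
    by-cases (no ¬lt) (no ¬e) = contradiction inv
      (<-asym (s-monotone k (≮∧≢⇒> ¬lt (≢ₙ⇒≢ r≢p ∘ sym ∘ to-injective (eval b))) ¬e))

  ℓ-exchange : ∀ u w r p → r ≢ₙ p → r < p → to w p < to w r → (∀ i → to u i ≡ to w (swap r p i)) → ℓ u ℕ.< ℓ w
  ℓ-exchange u w r p r≢p r<p inv e =
    let (a , len , ea) , _ = ℓ-spec w
        b , len′ , eb = exchange a r p r≢p r<p (subst₂ _<_ (sym (ea p)) (sym (ea r)) inv)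
    in subst (ℓ u ℕ.<_) (trans (sym len′) len)
         (s≤s (proj₂ (ℓ-spec u) b (λ i → trans (eb i) (trans (ea (swap r p i)) (sym (e i))))))

  -- Moves the leading letter over to the target, so that an induction on the word can let `v` vary.
  shift : ∀ k v b → ⟦ eval (k ∷ b) ≟ v ⟧ ≡ ⟦ eval b ≟ s k ∙ v ⟧
  shift k v b = ⟦⟧-cong (eval (k ∷ b) ≟ v) (eval b ≟ s k ∙ v)
    (λ e i → trans (sym (s-involutive k (to (eval b) i))) (cong (to (s k)) (e i)))
    (λ e i → trans (cong (to (s k)) (e i)) (s-involutive k (to v i)))

  -- Telescoping of the signs.

  module _ (r p : ℤ) (r≢p : r ≢ₙ p) where

    -- The potential of the telescope: it changes only at letters that exchange the images of `r`
    -- and `p`, and there by the sign of the letter.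
    order : S̃ → ℤ
    order w = ⟦ to w p <? to w r ⟧

    private
      -- Deleting `k` leaves `eval b`, which is `v` exactly when `s k` exchanges the images `X` of
      -- `r` and `Y` of `p`. In that case `X` moves up if the letter creates the inversion and down
      -- if it removes it.
      step : ∀ k b v → (∀ i → to v i ≡ to (s k) (to (eval b) (swap r p i))) →
            Dec (to (eval b) p ≡ to (s k) (to (eval b) r)) →
            crossing k (to (eval b) r) * ⟦ eval b ≟ v ⟧ ≡ order (eval (k ∷ b)) - order (eval b)
      step k b v ev (no ¬e) = begin
        crossing k X * ⟦ eval b ≟ v ⟧    ≡⟨ cong (crossing k X *_) (⟦⟧-no (eval b ≟ v) λ e → ¬e (sym (trans
                                              (cong (to (s k)) (trans (e r) (trans (ev r) (cong (to (s k) ∘ to (eval b)) (t-r r p r≢p)))))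
                                              (s-involutive k Y)))) ⟩
        crossing k X * 0ℤ                ≡⟨ *-zeroʳ (crossing k X) ⟩
        0ℤ                               ≡⟨ i≡j⇒i-j≡0 (sym same) ⟨
        order (eval (k ∷ b)) - order (eval b) ∎
        where
        open ≡-Reasoning
        X = to (eval b) r
        Y = to (eval b) p
        same : order (eval b) ≡ order (eval (k ∷ b))
        same = ⟦⟧-cong (Y <? X) (to (s k) Y <? to (s k) X)
          (λ Y<X → s-monotone k Y<X λ e → ¬e (sym (trans (cong (to (s k)) e) (s-involutive k Y))))
          (λ lt → subst₂ _<_ (s-involutive k Y) (s-involutive k X)
            (s-monotone k lt λ e → ¬e (sym (trans e (s-involutive k Y)))))
      step k b v ev (yes e) = moved (moves? k X)
        where
        open ≡-Reasoning
        X = to (eval b) r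
        Y = to (eval b) p
        hit : Moves k X → ⟦ eval b ≟ v ⟧ ≡ 1ℤ
        hit m = ⟦⟧-yes (eval b ≟ v) λ i → trans (reflect (eval b) k r p m e i) (sym (ev i))
        sY : to (s k) Y ≡ X
        sY = trans (cong (to (s k)) e) (s-involutive k X)
        ends : X < Y → order (eval (k ∷ b)) - order (eval b) ≡ 1ℤ
        ends lt = cong₂ _-_ (⟦⟧-yes (to (s k) Y <? to (s k) X) (subst₂ _<_ (sym sY) e lt)) (⟦⟧-no (Y <? X) (<-asym lt))
        starts : Y < X → order (eval (k ∷ b)) - order (eval b) ≡ - 1ℤ
        starts lt = cong₂ _-_ (⟦⟧-no (to (s k) Y <? to (s k) X) (<-asym (subst₂ _<_ e (sym sY) lt))) (⟦⟧-yes (Y <? X) lt)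
        moved : Moves k X ⊎ (residue X ≢ k × residue (X - 1ℤ) ≢ k) →
                crossing k X * ⟦ eval b ≟ v ⟧ ≡ order (eval (k ∷ b)) - order (eval b)
        moved (inj₁ (up u)) = trans (cong₂ _*_ (crossing-up {k} {X} u) (hit (up u)))
          (sym (ends (subst (X <_) (sym (trans e (s-up {k} {X} u))) (i<i+1 X))))
        moved (inj₁ (down d)) = trans (cong₂ _*_ (crossing-down {k} {X} d) (hit (down d)))
          (sym (starts (subst (_< X) (sym (trans e (s-down {k} {X} d))) (i-1<i X))))
        moved (inj₂ (¬u , ¬d)) = contradiction (to-injective (eval b) (sym (trans e (s-fix ¬u ¬d)))) (≢ₙ⇒≢ r≢p)

    -- Every deletion that yields v is a letter exchanging the images of r and p, so the signs telescope.
    ∂-telescopes : ∀ b v → (∀ i → to v i ≡ to (eval b) (swap r p i)) →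
                   ∂ r b (λ g → ⟦ eval g ≟ v ⟧) ≡ order (eval b) - ⟦ p <? r ⟧
    ∂-telescopes []      v ev = sym (i≡j⇒i-j≡0 {⟦ p <? r ⟧} refl)
    ∂-telescopes (k ∷ b) v ev = begin
      crossing k X * ⟦ eval b ≟ v ⟧ + ∂ r b (λ g → ⟦ eval (k ∷ g) ≟ v ⟧)
        ≡⟨ cong₂ _+_ (step k b v ev (to (eval b) p ℤ.≟ to (s k) X)) (trans (∂-cong r b (shift k v))
             (∂-telescopes b (s k ∙ v) (λ i → trans (cong (to (s k)) (ev i)) (s-involutive k _)))) ⟩
      (order (eval (k ∷ b)) - order (eval b)) + (order (eval b) - ⟦ p <? r ⟧)
        ≡⟨ l (order (eval (k ∷ b))) (order (eval b)) ⟦ p <? r ⟧ ⟩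
      order (eval (k ∷ b)) - ⟦ p <? r ⟧ ∎
      where
      open ≡-Reasoning
      X = to (eval b) r
      l : ∀ a b c → (a - b) + (b - c) ≡ a - c
      l = solve-∀

  -- Deleting a letter of nonzero sign always amounts to some `t_{r,p}`: take for `p` the preimage,
  -- under the suffix, of the point to which the letter moves the image of `r`.
  ∂-vanishes : ∀ r b v → (∀ p → r ≢ₙ p → ¬ (∀ i → to v i ≡ to (eval b) (swap r p i))) →
               ∂ r b (λ g → ⟦ eval g ≟ v ⟧) ≡ 0ℤ
  ∂-vanishes r []      v none = refl
  ∂-vanishes r (k ∷ b) v none = cong₂ _+_ (head (moves? k X)) (trans (∂-cong r b (shift k v))
    (∂-vanishes r b (s k ∙ v) λ p r≢p e → none p r≢p λ i → trans (sym (s-involutive k (to v i))) (cong (to (s k)) (e i))))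
    where
    X = to (eval b) r
    miss : Moves k X → ¬ (eval b ≈ v)
    miss m e = none p r≢p λ i → trans (sym (e i)) (reflect (eval b) k r p m Y i)
      where
      p = from (eval b) (to (s k) X)
      Y : to (eval b) p ≡ to (s k) X
      Y = strictlyInverseˡ (eval b) (to (s k) X)
      r≢p : r ≢ₙ p
      r≢p c = moves-≢ m (≡ₙ-trans (≡ₙ-trans (≡ₙ-reflexive (to-≡ₙ (eval b) c)) (≡ₙ-translate (to (eval b) p) c)) (≡ₙ-reflexive Y))
    head : Moves k X ⊎ (residue X ≢ k × residue (X - 1ℤ) ≢ k) → crossing k X * ⟦ eval b ≟ v ⟧ ≡ 0ℤ
    head (inj₁ m) = trans (cong (crossing k X *_) (⟦⟧-no (eval b ≟ v) (miss m))) (*-zeroʳ (crossing k X))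
    head (inj₂ (¬u , ¬d)) = trans (cong (_* ⟦ eval b ≟ v ⟧) (crossing-fix {k} {X} ¬u ¬d)) (*-zeroˡ ⟦ eval b ≟ v ⟧)

  -- From ∂ to right and left covers.

  swap-comm : ∀ r p → r ≢ₙ p → ∀ i → swap r p i ≡ swap p r i
  swap-comm r p r≢p i = by-cases (i ≡ₙ? r) (i ≡ₙ? p)
    where
    by-cases : Dec (i ≡ₙ r) → Dec (i ≡ₙ p) → swap r p i ≡ swap p r i
    by-cases (yes d) _       = trans (swap-r r p d) (sym (swap-s p r (λ c → r≢p (≡ₙ-trans (≡ₙ-sym d) c)) d))
    by-cases (no ¬d) (yes c) = trans (swap-s r p ¬d c) (sym (swap-r p r c))
    by-cases (no ¬d) (no ¬c) = trans (swap-other r p ¬d ¬c) (sym (swap-other p r ¬c ¬d))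

  module _ (r : ℤ) (v w : S̃) where

    unswap : ∀ {p} → r ≢ₙ p → (∀ i → to w i ≡ to v (swap r p i)) → ∀ i → to v i ≡ to w (swap r p i)
    unswap {p} r≢p e i = sym (trans (e (swap r p i)) (cong (to v) (swap-involutive r p r≢p i)))

    right⇒swap : IsRightCover r v w → ∃ λ p → r ≢ₙ p × r < p × (∀ i → to v i ≡ to w (swap r p i))
    right⇒swap (_ , p , r≢p , r<p , e) = p , r≢p , r<p , unswap r≢p e

    left⇒swap : IsLeftCover r v w → ∃ λ p → r ≢ₙ p × p < r × (∀ i → to v i ≡ to w (swap r p i))
    left⇒swap (_ , p , p≢r , p<r , e) = p , p≢r ∘ ≡ₙ-sym , p<r ,
      unswap (p≢r ∘ ≡ₙ-sym) (λ i → trans (e i) (cong (to v) (swap-comm p r p≢r i)))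

    partner-unique : ∀ {p} → r ≢ₙ p → (∀ i → to v i ≡ to w (swap r p i)) → from w (to v r) ≡ p
    partner-unique {p} r≢p e = trans (cong (from w) (trans (e r) (cong (to w) (t-r r p r≢p)))) (strictlyInverseʳ w p)

  -- The only possible partner of `r` is the `p` that `w` maps to `to v r`. If `v` is `w t_{r,p}`,
  -- the telescope leaves, up to sign, the indicator that `w` is longer than `v`, and this is the
  -- condition for a right cover if `r < p` and for a left cover if `p < r`. Otherwise both sides
  -- vanish.
  cover-difference : ∀ r a v → length a ≡ suc (ℓ v) →
                     ∂ r a (λ g → ⟦ eval g ≟ v ⟧) ≡ ⟦ right? r v (eval a) ⟧ - ⟦ left? r v (eval a) ⟧
  cover-difference r a v len = by-cases (r ≡ₙ? p)
    where
    w = eval a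
    p = from w (to v r)
    R = right? r v w
    L = left? r v w
    Swap : Set
    Swap = ∀ i → to v i ≡ to w (swap r p i)

    from-partner : ∀ {q} → r ≢ₙ q → (∀ i → to v i ≡ to w (swap r q i)) → q ≡ p
    from-partner r≢q e = sym (partner-unique r v w r≢q e)

    vanish : (∀ q → r ≢ₙ q → ¬ (∀ i → to v i ≡ to w (swap r q i))) →
             ∂ r a (λ g → ⟦ eval g ≟ v ⟧) ≡ ⟦ R ⟧ - ⟦ L ⟧
    vanish none = trans (∂-vanishes r a v none) (sym (cong₂ _-_
      (⟦⟧-no R λ c → let q , r≢q , _ , e = right⇒swap r v w c in none q r≢q e)
      (⟦⟧-no L λ c → let q , r≢q , _ , e = left⇒swap r v w c in none q r≢q e)))

    swapped : r ≢ₙ p → Swap → ∂ r a (λ g → ⟦ eval g ≟ v ⟧) ≡ ⟦ R ⟧ - ⟦ L ⟧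
    swapped r≢p e = trans (∂-telescopes r p r≢p a v e) (by-order (<-cmp r p))
      where
      e⁻ : ∀ i → to w i ≡ to v (swap r p i)
      e⁻ i = sym (trans (e (swap r p i)) (cong (to w) (swap-involutive r p r≢p i)))
      vr : to v r ≡ to w p
      vr = trans (e r) (cong (to w) (t-r r p r≢p))
      vp : to v p ≡ to w r
      vp = trans (e p) (cong (to w) (t-s r p r≢p))
      w-≢ : to w r ≢ to w p
      w-≢ = ≢ₙ⇒≢ r≢p ∘ to-injective w
      -- The word `a` may be non-reduced, but its length still bounds `ℓ w` from above by
      -- `suc (ℓ v)`.
      longer : ℓ v ℕ.< ℓ w → ℓ w ≡ suc (ℓ v)
      longer lt = ℕ.≤-antisym (subst (ℓ w ℕ.≤_) len (proj₂ (ℓ-spec w) a (λ _ → refl))) lt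
      by-order : Tri (r < p) (r ≡ p) (p < r) → ⟦ to w p <? to w r ⟧ - ⟦ p <? r ⟧ ≡ ⟦ R ⟧ - ⟦ L ⟧
      by-order (tri≈ _ r≡p _) = contradiction r≡p (≢ₙ⇒≢ r≢p)
      by-order (tri< r<p _ p≮r) = cong₂ _-_
        (⟦⟧-cong (to w p <? to w r) R
          (λ lt → ((r , p , r≢p , e⁻) , longer (ℓ-exchange v w r p r≢p r<p lt e)) , p , r≢p , r<p , e⁻)
          (λ { ((_ , l≡) , _) → Dec.decidable-stable (to w p <? to w r) λ w≮ → ℕ.<-asym
            (ℓ-exchange w v r p r≢p r<p (subst₂ _<_ (sym vp) (sym vr) (≮∧≢⇒> w≮ (w-≢ ∘ sym))) e⁻)
            (ℕ.≤-reflexive (sym l≡)) }))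
        (trans (⟦⟧-no (p <? r) p≮r) (sym (⟦⟧-no L λ c →
          let q , r≢q , q<r , e′ = left⇒swap r v w c in p≮r (subst (_< r) (from-partner r≢q e′) q<r))))
      -- Now the telescope starts from `⟦ p <? r ⟧`, which is 1, so what remains is minus the
      -- indicator of the opposite order of the values.
      by-order (tri> r≮p _ p<r) = begin
        ⟦ to w p <? to w r ⟧ - ⟦ p <? r ⟧   ≡⟨ complement (to w p <? to w r) (to w r <? to w p) ⟩
        0ℤ - ⟦ to w r <? to w p ⟧           ≡⟨ cong₂ _-_ (sym (⟦⟧-no R λ c →
                                                  let q , r≢q , r<q , e′ = right⇒swap r v w c in r≮p (subst (r <_) (from-partner r≢q e′) r<q)))
                                                (⟦⟧-cong (to w r <? to w p) L
          (λ lt → ((r , p , r≢p , e⁻) , longer (ℓ-exchange v w p r p≢r p<r lt (λ i → trans (e i) (cong (to w) (swap-comm r p r≢p i)))))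
            , p , p≢r , p<r , λ i → trans (e⁻ i) (cong (to v) (swap-comm r p r≢p i)))
          (λ { ((_ , l≡) , _) → Dec.decidable-stable (to w r <? to w p) λ w≮ → ℕ.<-asym
            (ℓ-exchange w v p r p≢r p<r (subst₂ _<_ (sym vr) (sym vp) (≮∧≢⇒> w≮ w-≢)) λ i → trans (e⁻ i) (cong (to v) (swap-comm r p r≢p i)))
            (ℕ.≤-reflexive (sym l≡)) })) ⟩
        ⟦ R ⟧ - ⟦ L ⟧                       ∎
        where
        open ≡-Reasoning
        p≢r : p ≢ₙ r
        p≢r = r≢p ∘ ≡ₙ-sym
        complement : ∀ (A? : Dec (to w p < to w r)) (B? : Dec (to w r < to w p)) →
                     ⟦ A? ⟧ - ⟦ p <? r ⟧ ≡ 0ℤ - ⟦ B? ⟧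
        complement A? (yes b) = cong₂ _-_ (⟦⟧-no A? (<-asym b)) (⟦⟧-yes (p <? r) p<r)
        complement A? (no ¬b) = cong₂ _-_ (⟦⟧-yes A? (≮∧≢⇒> ¬b w-≢)) (⟦⟧-yes (p <? r) p<r)

    by-cases : Dec (r ≡ₙ p) → ∂ r a (λ g → ⟦ eval g ≟ v ⟧) ≡ ⟦ R ⟧ - ⟦ L ⟧
    by-cases (yes r≡p) = vanish λ q r≢q e → r≢q (subst (r ≡ₙ_) (sym (from-partner r≢q e)) r≡p)
    by-cases (no r≢p)  = inner (v ≟ w ∙ t r p r≢p)
      where
      inner : Dec (v ≈ w ∙ t r p r≢p) → ∂ r a (λ g → ⟦ eval g ≟ v ⟧) ≡ ⟦ R ⟧ - ⟦ L ⟧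
      inner (yes e) = swapped r≢p e
      inner (no ¬e) = vanish λ q r≢q e → ¬e (λ i → trans (e i) (cong (λ z → to w (swap r z i)) (from-partner r≢q e)))

  -- Deleting a letter from a descending word.

  infixl 6 _─_

  _─_ : Word → Fin n → Word
  a ─ j = filter (λ k → Dec.¬? (k Fin.≟ j)) a

  ─-other : ∀ {k j} b → j ≢ k → (k ∷ b) ─ j ≡ k ∷ (b ─ j)
  ─-other {j = j} b j≢k = List.filter-accept (λ k → Dec.¬? (k Fin.≟ j)) (j≢k ∘ sym)

  ─-same : ∀ {k b} → k ∉ b → (k ∷ b) ─ k ≡ b
  ─-same {k} {b} k∉ = trans (List.filter-reject (λ l → Dec.¬? (l Fin.≟ k)) (λ ≢ → ≢ refl))
    (List.filter-all (λ l → Dec.¬? (l Fin.≟ k)) (All.tabulate λ l∈ l≡k → k∉ (subst (_∈ b) l≡k l∈)))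

  -- The sign of a deleted letter `j`, expressed through the remaining word `b` alone and not
  -- through the place where `j` stood.
  weight : ℤ → Word → Fin n → ℤ
  weight r b j = ⟦ residue (to (eval b) r) Fin.≟ j ⟧ - ⟦ residue (r - 1ℤ) Fin.≟ j ⟧

  -- The two indicators in `crossing` are transported in opposite directions. The letters left of
  -- `j` fix the points congruent to `j`, so the first can be read off after the whole remaining
  -- word; the letters right of `j` fix the points congruent to `j + 1`, so the second can be read
  -- off at `r`.
  ∂-descending : ∀ r {a} → Descending a → ∀ f → ∂ r a f ≡ (∑[ j ← a ] weight r (a ─ j) j * f (a ─ j))
  ∂-descending r {[]}    []       f = refl
  ∂-descending r {k ∷ b} (av ∷ d) f = cong₂ _+_
    (trans (cong (λ z → (⟦ residue X Fin.≟ k ⟧ - z) * f b) base)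
      (cong (λ c → weight r c k * f c) (sym (─-same k∉))))
    (trans (∂-descending r d (f ∘ (k ∷_))) (sum-cong-∈ b λ {j} j∈ → trans
      (cong (λ z → (z - ⟦ residue (r - 1ℤ) Fin.≟ j ⟧) * f (k ∷ (b ─ j))) (moved j (All.lookup av j∈) (to (eval (b ─ j)) r)))
      (cong (λ c → weight r c j * f c) (sym (─-other b (proj₁ (All.lookup av j∈)))))))
    where
    X = to (eval b) r
    k∉ : k ∉ b
    k∉ k∈ = proj₁ (All.lookup av k∈) refl
    base : ⟦ residue (X - 1ℤ) Fin.≟ k ⟧ ≡ ⟦ residue (r - 1ℤ) Fin.≟ k ⟧
    base = ⟦⟧-cong (residue (X - 1ℤ) Fin.≟ k) (residue (r - 1ℤ) Fin.≟ k)
      (λ e → subst (λ x → residue (x - 1ℤ) ≡ k) (to-injective (eval b) {X} {r} (tail-fixes av e)) e)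
      (λ e → subst (λ x → residue (x - 1ℤ) ≡ k) (sym (tail-fixes av e)) e)
    moved : ∀ j → Before k j → ∀ x → ⟦ residue x Fin.≟ j ⟧ ≡ ⟦ residue (to (s k) x) Fin.≟ j ⟧
    moved j (j≢k , j≢next) x = ⟦⟧-cong (residue x Fin.≟ j) (residue (to (s k) x) Fin.≟ j)
      (λ e → trans (cong residue (fixed x e)) e)
      (λ e → trans (cong residue (trans (sym (s-involutive k x)) (fixed (to (s k) x) e))) e)
      where
      fixed : ∀ x → residue x ≡ j → to (s k) x ≡ x
      fixed x e = s-fix {k} {x} (λ e′ → j≢k (trans (sym e) e′))
        (λ e′ → j≢next (trans (sym e) (trans (residue-next x) (cong next e′))))

  -- A normal form for each proper subset of the letters.

  ≡ₙ-+-cancelˡ : ∀ {x y} c → c + x ≡ₙ c + y → x ≡ₙ y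
  ≡ₙ-+-cancelˡ {x} {y} c (congruent d) = congruent (subst (N ∣_) (l c x y) d)
    where
    l : ∀ c x y → c + x - (c + y) ≡ x - y
    l = solve-∀

  residue-≡ : ∀ {x y} → residue x ≡ residue y → x ≡ₙ y
  residue-≡ {x} {y} e = ≡ₙ-trans (residue-toℕ⁻ {x} e) (≡ₙ-sym (residue-≡ₙ y))

  -- All letters other than `p`, from `p - 1` down to `p + 1`: the offsets from `p` run from `n - 1`
  -- to 1.
  rotation : Fin n → Word
  rotation p = applyDownFrom (λ i → residue (+ toℕ p + + suc i)) (ℕ.pred n)

  rotation-descending : ∀ p → Descending (rotation p)
  rotation-descending p = AllPairs.applyDownFrom⁺₁ _ (ℕ.pred n) λ {i} {j} j<i i<n-1 →
    let si<n = ℕ.≤-trans (s≤s i<n-1) (ℕ.≤-reflexive (ℕ.suc-pred n))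
        sj<n = ℕ.<-trans (s≤s j<i) si<n
    in (λ e → ℕ.<⇒≢ j<i (ℕ.suc-injective (small-≡ₙ sj<n si<n (≡ₙ-+-cancelˡ (+ toℕ p) (residue-≡ e)))))
     -- Cancelling `p + 1` instead of `p` compares `j` with `suc i`, and both are below `n`.
     , (λ e → ℕ.<⇒≢ (ℕ.m<n⇒m<1+n j<i) (small-≡ₙ (ℕ.<-trans (ℕ.n<1+n j) sj<n) si<n
         (≡ₙ-+-cancelˡ (+ toℕ p + 1ℤ) (≡ₙ-trans (≡ₙ-reflexive (+-assoc (+ toℕ p) 1ℤ (+ j)))
           (≡ₙ-trans (residue-≡ (trans e (sym (residue-suc (+ toℕ p + + suc i))))) (≡ₙ-reflexive (l (+ toℕ p) (+ suc i))))))))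
    where
    l : ∀ p i → p + i + 1ℤ ≡ p + 1ℤ + i
    l = solve-∀

  ∈-rotation : ∀ {p k} → k ≢ p → k ∈ rotation p
  ∈-rotation {p} {k} k≢p = subst (_∈ rotation p) (residue-toℕ⁺ sum≡)
    (Mem.∈-applyDownFrom⁺ (λ i → residue (+ toℕ p + + suc i)) (ℕ.≤∧≢⇒< (ℕ.<⇒≤pred (Fin.toℕ<n offset)) i≢))
    where
    -- The solution `i` of `p + 1 + i = k` modulo `n`; its largest value `n - 1` would give `k = p`.
    offset = residue (+ toℕ k - + toℕ p - 1ℤ)
    i = toℕ offset
    sum≡ : + toℕ p + + suc i ≡ₙ + toℕ k
    sum≡ = ≡ₙ-trans (≡ₙ-reflexive (l (+ toℕ p) (+ i)))
      (≡ₙ-trans (≡ₙ-+ (+ toℕ p + 1ℤ) (≡ₙ-sym (residue-≡ₙ (+ toℕ k - + toℕ p - 1ℤ)))) (≡ₙ-reflexive (l′ (+ toℕ k) (+ toℕ p))))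
      where
      l : ∀ p i → p + (1ℤ + i) ≡ i + (p + 1ℤ)
      l = solve-∀
      l′ : ∀ k p → k - p - 1ℤ + (p + 1ℤ) ≡ k
      l′ = solve-∀
    i≢ : i ≢ ℕ.pred n
    i≢ e = k≢p (trans (sym (residue-toℕ k)) (trans (residue-cong (≡ₙ-trans (≡ₙ-sym sum≡)
      (≡ₙ-trans (≡ₙ-reflexive (cong (λ m → + toℕ p + + m) (trans (cong suc e) (ℕ.suc-pred n)))) (≡ₙ-shift (+ toℕ p))))) (residue-toℕ p)))

  pivot : LetterSet n → Fin n
  pivot A with Fin.any? (λ k → Dec.¬? (k ∈? A))
  ... | yes (k , _) = k
  -- A default for the full set, which the hypothesis `size A < n` of later lemmas excludes.
  ... | no _        = residue 0ℤ

  pivot-∉ : ∀ {A} → size A ℕ.< n → lookup A (pivot A) ≢ true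
  pivot-∉ {A} A<n with Fin.any? (λ k → Dec.¬? (k ∈? A))
  ... | yes (_ , k∉) = k∉
  ... | no none      = contradiction (size<⇒∉ A A<n) none

  -- Cutting the circle of letters at one outside `A` leaves a linear order in which the letters of
  -- `A` are listed downwards.
  word : LetterSet n → Word
  word A = filter (_∈? A) (rotation (pivot A))

  word-descending : ∀ A → Descending (word A)
  word-descending A = AllPairs.filter⁺ (_∈? A) (rotation-descending (pivot A))

  ∈-word⁺ : ∀ {A} → size A ℕ.< n → ∀ {k} → lookup A k ≡ true → k ∈ word A
  ∈-word⁺ {A} A<n k∈ = ∈-filter⁺ (_∈? A) (∈-rotation (λ { refl → pivot-∉ {A} A<n k∈ })) k∈

  ∈-word⁻ : ∀ {A k} → k ∈ word A → lookup A k ≡ true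
  ∈-word⁻ {A} k∈ = proj₂ (∈-filter⁻ (_∈? A) {xs = rotation (pivot A)} k∈)

  length-word : ∀ {A} → size A ℕ.< n → length (word A) ≡ size A
  length-word {A} A<n = length-unique (Fin.≡-decSetoid n) (descending-distinct (word-descending A)) (members-distinct A)
    (∈-members⁺ {A = A} ∘ ∈-word⁻ {A}) (∈-word⁺ {A} A<n ∘ ∈-members⁻ {A = A})

  eval-word-injective : ∀ {A B} → size A ℕ.< n → size B ℕ.< n → eval (word A) ≈ eval (word B) → A ≡ B
  eval-word-injective {A} {B} A<n B<n e = lookup-ext
    (λ k k∈ → ∈-word⁻ {B} (support (word B) (word-descending A) (λ i → sym (e i)) (∈-word⁺ {A} A<n k∈)))
    (λ k k∈ → ∈-word⁻ {A} (support (word A) (word-descending B) e (∈-word⁺ {B} B<n k∈)))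

  size-setOf : ∀ {a} → Descending a → size (setOf a) ≡ length a
  size-setOf {a} d = length-unique (Fin.≡-decSetoid n) (members-distinct (setOf a)) (descending-distinct d)
    (∈-setOf⁻ {a = a} ∘ ∈-members⁻ {A = setOf a}) (∈-members⁺ {A = setOf a} ∘ ∈-setOf⁺)

  descending-length< : ∀ {a} → Descending a → length a ℕ.< n
  descending-length< {[]}    d = ℕ.<-trans (s≤s z≤n) 2≤n
  descending-length< {k ∷ a} d = subst (ℕ._< n) (size-setOf d)
    (∉⇒size< {k = next k} {A = setOf (k ∷ a)} (descending-next∉ d ∘ ∈-setOf⁻ {a = k ∷ a}))

  HasSize : ℕ → LetterSet n → Set
  HasSize l A = size A ≡ l × l ℕ.< n

  hasSize? : ∀ l → Decidable (HasSize l)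
  hasSize? l A = (size A ℕ.≟ l) ×-dec (l ℕ.<? n)

  -- The summands of `h_l`: one word for each cyclically decreasing element of length `l`, hence
  -- none if `l` is at least `n`.
  blocks : ℕ → List Word
  blocks l = map word (filter (hasSize? l) (subsets n))

  block-descending : ∀ l {a} → a ∈ blocks l → Descending a
  block-descending l a∈ with Mem.∈-map⁻ word a∈
  ... | A , _ , refl = word-descending A

  block-length : ∀ l {a} → a ∈ blocks l → length a ≡ l
  block-length l a∈ with Mem.∈-map⁻ word a∈
  ... | A , A∈ , refl with ∈-filter⁻ (hasSize? l) {xs = subsets n} A∈
  ...   | _ , refl , A<n = length-word {A} A<n

  represent : ∀ {a} → Descending a → ∃ λ b → b ∈ blocks (length a) × eval b ≈ eval a
  represent {a} d = word A , Mem.∈-map⁺ word (∈-filter⁺ (hasSize? (length a)) (∈-subsets A) (size-setOf d , descending-length< d)) ,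
    eval-determined (word-descending A) d (∈-setOf⁻ {a = a} ∘ ∈-word⁻ {A})
      (∈-word⁺ {A} (subst (ℕ._< n) (sym (size-setOf d)) (descending-length< d)) ∘ ∈-setOf⁺)
    where A = setOf a

  -- Vanishing of ∂ on blocks and on their products.

  Respecting : (Word → ℤ) → Set
  Respecting f = ∀ {a b} → eval a ≈ eval b → f a ≡ f b

  sum-delta : ∀ {m} (k : Fin m) (h : Fin m → ℤ) → (∑[ j ← allFin m ] ⟦ k Fin.≟ j ⟧ * h j) ≡ h k
  sum-delta {m} k h = begin
    (∑[ j ← allFin m ] ⟦ k Fin.≟ j ⟧ * h j)   ≡⟨ sum-cong (allFin m) replace ⟩
    (∑[ j ← allFin m ] h k * ⟦ k Fin.≟ j ⟧)   ≡⟨ sum-*ˡ (allFin m) (h k) _ ⟩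
    h k * (∑[ j ← allFin m ] ⟦ k Fin.≟ j ⟧)   ≡⟨ cong (h k *_) (count (Fin.≡-decSetoid m) (λ j → Any.any? (j Fin.≟_) (allFin m))
                                                  (Distinct.allFin⁺ m) k id id) ⟩
    h k * ⟦ Any.any? (k Fin.≟_) (allFin m) ⟧  ≡⟨ cong (h k *_) (⟦⟧-yes (Any.any? (k Fin.≟_) (allFin m)) (∈-allFin k)) ⟩
    h k * 1ℤ                                  ≡⟨ *-identityʳ (h k) ⟩
    h k                                       ∎
    where
    open ≡-Reasoning
    replace : ∀ j → ⟦ k Fin.≟ j ⟧ * h j ≡ h k * ⟦ k Fin.≟ j ⟧
    replace j with k Fin.≟ j
    ... | yes refl = *-comm 1ℤ (h k)
    ... | no _     = trans (*-zeroˡ (h j)) (sym (*-zeroʳ (h k)))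

  -- The letter exchanged upwards with r is the first letter from r on outside A, the one exchanged
  -- downwards is r − 1; both exist exactly when r − 1 is outside A.
  weights-cancel : ∀ r A → size A ℕ.< n →
    (∑[ j ← allFin n ] ⟦ Dec.¬? (j ∈? A) ⟧ * weight r (word A) j) ≡ 0ℤ
  weights-cancel r A A<n = begin
    (∑[ j ← allFin n ] ⟦ Dec.¬? (j ∈? A) ⟧ * weight r (word A) j)
      ≡⟨ sum-cong (allFin n) (λ j → l ⟦ Dec.¬? (j ∈? A) ⟧ ⟦ y Fin.≟ j ⟧ ⟦ z Fin.≟ j ⟧) ⟩
    (∑[ j ← allFin n ] (⟦ y Fin.≟ j ⟧ * ⟦ Dec.¬? (j ∈? A) ⟧ - ⟦ z Fin.≟ j ⟧ * ⟦ Dec.¬? (j ∈? A) ⟧))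
      ≡⟨ sum-- (allFin n) (λ j → ⟦ y Fin.≟ j ⟧ * ⟦ Dec.¬? (j ∈? A) ⟧) (λ j → ⟦ z Fin.≟ j ⟧ * ⟦ Dec.¬? (j ∈? A) ⟧) ⟩
    (∑[ j ← allFin n ] ⟦ y Fin.≟ j ⟧ * ⟦ Dec.¬? (j ∈? A) ⟧) - (∑[ j ← allFin n ] ⟦ z Fin.≟ j ⟧ * ⟦ Dec.¬? (j ∈? A) ⟧)
      ≡⟨ cong₂ _-_ (sum-delta y (λ j → ⟦ Dec.¬? (j ∈? A) ⟧)) (sum-delta z (λ j → ⟦ Dec.¬? (j ∈? A) ⟧)) ⟩
    ⟦ Dec.¬? (y ∈? A) ⟧ - ⟦ Dec.¬? (z ∈? A) ⟧
      ≡⟨ i≡j⇒i-j≡0 (⟦⟧-cong (Dec.¬? (y ∈? A)) (Dec.¬? (z ∈? A))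
           (λ y∉ z∈ → y∉ (subst (λ k → lookup A k ≡ true) (sym (stepped z∈)) z∈)) (λ z∉ y∈ → RunEnd.absent (ran z∉) (∈-word⁺ {A} A<n y∈))) ⟩
    0ℤ ∎
    where
    open ≡-Reasoning
    y = residue (to (eval (word A)) r)
    z = residue (r - 1ℤ)
    stepped : lookup A z ≡ true → y ≡ z
    stepped z∈ = cong residue (descending-step (word-descending A) (∈-word⁺ {A} A<n z∈))
    ran : lookup A z ≢ true → RunEnd (word A) r (to (eval (word A)) r)
    ran z∉ = descending-run (word-descending A) (z∉ ∘ ∈-word⁻ {A})
    l : ∀ a y z → a * (y - z) ≡ y * a - z * a
    l = solve-∀

  module _ (r : ℤ) (f : Word → ℤ) (resp : Respecting f) where

    term : LetterSet n → Fin n → ℤ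
    term B j = weight r (word B) j * f (word B)

    -- `word A ─ j` and `word (toggle j A)` may be cut at different letters, but they have the same
    -- letters, hence the same value, and `f` depends on the value only.
    ∂-word : ∀ A → size A ℕ.< n → ∂ r (word A) f ≡ (∑[ j ← allFin n ] ⟦ j ∈? A ⟧ * term (toggle j A) j)
    ∂-word A A<n = begin
      ∂ r (word A) f
        ≡⟨ ∂-descending r (word-descending A) f ⟩
      (∑[ j ← word A ] weight r (word A ─ j) j * f (word A ─ j))
        ≡⟨ sum-cong-∈ (word A) (λ {j} j∈ → cong₂ _*_
             (cong (λ x → ⟦ residue x Fin.≟ j ⟧ - ⟦ residue (r - 1ℤ) Fin.≟ j ⟧) (deleted (∈-word⁻ {A} j∈) r)) (resp (deleted (∈-word⁻ {A} j∈)))) ⟩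
      (∑[ j ← word A ] term (toggle j A) j)
        ≡⟨ sum-unique (Fin.≡-decSetoid n) (descending-distinct (word-descending A)) (members-distinct A)
             (∈-members⁺ {A = A} ∘ ∈-word⁻ {A}) (∈-word⁺ {A} A<n ∘ ∈-members⁻ {A = A}) (λ j → term (toggle j A) j) (λ { refl → refl }) ⟩
      (∑[ j ← members A ] term (toggle j A) j)
        ≡⟨ sum-filter (_∈? A) (allFin n) _ ⟩
      (∑[ j ← allFin n ] ⟦ j ∈? A ⟧ * term (toggle j A) j) ∎
      where
      open ≡-Reasoning
      deleted : ∀ {j} → lookup A j ≡ true → eval (word A ─ j) ≈ eval (word (toggle j A))
      deleted {j} j∈ = eval-determined (AllPairs.filter⁺ ≢j? (word-descending A)) (word-descending (toggle j A))
        (λ k∈ → let k∈A , k≢j = ∈-filter⁻ ≢j? {xs = word A} k∈ in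
          ∈-word⁺ {toggle j A} (∉⇒size< {A = toggle j A} j∉) (trans (lookup-toggle-≢ A k≢j) (∈-word⁻ {A} k∈A)))
        (λ {k} k∈ → let k≢j = λ k≡j → j∉ (subst (λ k → lookup (toggle j A) k ≡ true) k≡j (∈-word⁻ {toggle j A} k∈)) in
          ∈-filter⁺ ≢j? (∈-word⁺ {A} A<n (trans (sym (lookup-toggle-≢ A k≢j)) (∈-word⁻ {toggle j A} k∈))) k≢j)
        where
        ≢j? = λ k → Dec.¬? (k Fin.≟ j)
        j∉ : lookup (toggle j A) j ≢ true
        j∉ e = case trans (sym e) (trans (lookup-toggle j A) (cong not j∈)) of λ ()

    -- Sum over the pairs of a set and one of its letters `j`, and regroup by the set `B` left after
    -- deleting `j`. The coefficient of `f (word B)` is the sum in `weights-cancel`.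
    sum-∂-blocks : ∀ l → (∑[ a ← blocks l ] ∂ r a f) ≡ 0ℤ
    sum-∂-blocks l = begin
      (∑[ a ← blocks l ] ∂ r a f)
        ≡⟨ sum-map word (filter (hasSize? l) (subsets n)) _ ⟩
      (∑[ A ← filter (hasSize? l) (subsets n) ] ∂ r (word A) f)
        ≡⟨ sum-filter (hasSize? l) (subsets n) _ ⟩
      (∑[ A ← subsets n ] ⟦ hasSize? l A ⟧ * ∂ r (word A) f)
        ≡⟨ sum-cong (subsets n) expand ⟩
      (∑[ A ← subsets n ] ∑[ j ← allFin n ] ⟦ hasSize? l A ⟧ * (⟦ j ∈? A ⟧ * term (toggle j A) j))
        ≡⟨ sum-swap (subsets n) (allFin n) _ ⟩
      (∑[ j ← allFin n ] ∑[ A ← subsets n ] ⟦ hasSize? l A ⟧ * (⟦ j ∈? A ⟧ * term (toggle j A) j))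
        -- For fixed `j` substitute `A = toggle j B`: the condition that `j` is in `A` becomes that
        -- it is not in `B`, and `size A = l` becomes `suc (size B) = l`.
        ≡⟨ sum-cong (allFin n) (λ j → trans (sum-toggle j _) (sum-cong (subsets n) (toggled j))) ⟩
      (∑[ j ← allFin n ] ∑[ B ← subsets n ] (⟦ grows? B ⟧ * f (word B)) * (⟦ Dec.¬? (j ∈? B) ⟧ * weight r (word B) j))
        ≡⟨ sum-swap (allFin n) (subsets n) _ ⟩
      (∑[ B ← subsets n ] ∑[ j ← allFin n ] (⟦ grows? B ⟧ * f (word B)) * (⟦ Dec.¬? (j ∈? B) ⟧ * weight r (word B) j))
        ≡⟨ sum-zero (subsets n) (λ {B} _ → trans (sum-*ˡ (allFin n) (⟦ grows? B ⟧ * f (word B)) _) (cancel B (grows? B))) ⟩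
      0ℤ ∎
      where
      open ≡-Reasoning
      grows? : ∀ B → Dec (suc (size B) ≡ l × l ℕ.< n)
      grows? B = (suc (size B) ℕ.≟ l) ×-dec (l ℕ.<? n)
      expand : ∀ A → ⟦ hasSize? l A ⟧ * ∂ r (word A) f ≡ (∑[ j ← allFin n ] ⟦ hasSize? l A ⟧ * (⟦ j ∈? A ⟧ * term (toggle j A) j))
      expand A = trans (case-size (hasSize? l A)) (sym (sum-*ˡ (allFin n) ⟦ hasSize? l A ⟧ _))
        where
        case-size : ∀ (d : Dec (HasSize l A)) →
          ⟦ d ⟧ * ∂ r (word A) f ≡ ⟦ d ⟧ * (∑[ j ← allFin n ] ⟦ j ∈? A ⟧ * term (toggle j A) j)
        case-size (yes (refl , A<n)) = cong (1ℤ *_) (∂-word A A<n)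
        case-size (no _) = refl
      toggled : ∀ j B → ⟦ hasSize? l (toggle j B) ⟧ * (⟦ j ∈? toggle j B ⟧ * term (toggle j (toggle j B)) j) ≡
                (⟦ grows? B ⟧ * f (word B)) * (⟦ Dec.¬? (j ∈? B) ⟧ * weight r (word B) j)
      toggled j B = trans (cong₂ (λ b C → ⟦ hasSize? l (toggle j B) ⟧ * (b * term C j))
          (⟦⟧-cong (j ∈? toggle j B) (Dec.¬? (j ∈? B))
            (λ e j∈ → case trans (sym e) (trans (lookup-toggle j B) (cong not j∈)) of λ ())
            (λ j∉ → trans (lookup-toggle j B) (cong not (Bool.¬-not j∉))))
          (toggle-involutive j B))
        (outside (Dec.¬? (j ∈? B)))
        where
        l₁ : ∀ x w f → x * (1ℤ * (w * f)) ≡ x * f * (1ℤ * w)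
        l₁ = solve-∀
        l₂ : ∀ x y w f → x * (0ℤ * (w * f)) ≡ y * f * (0ℤ * w)
        l₂ = solve-∀
        outside : ∀ (d : Dec (lookup B j ≢ true)) → ⟦ hasSize? l (toggle j B) ⟧ * (⟦ d ⟧ * term B j) ≡
                  (⟦ grows? B ⟧ * f (word B)) * (⟦ d ⟧ * weight r (word B) j)
        outside (yes j∉) = trans (cong (_* (1ℤ * term B j)) (⟦⟧-cong (hasSize? l (toggle j B)) (grows? B)
            (λ (e , l<n) → trans (sym (size-toggle {A = B} j∉)) e , l<n) (λ (e , l<n) → trans (size-toggle {A = B} j∉) e , l<n)))
          (l₁ ⟦ grows? B ⟧ (weight r (word B) j) (f (word B)))
        outside (no _) = l₂ ⟦ hasSize? l (toggle j B) ⟧ ⟦ grows? B ⟧ (weight r (word B) j) (f (word B))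
      cancel : ∀ B (d : Dec (suc (size B) ≡ l × l ℕ.< n)) →
               (⟦ d ⟧ * f (word B)) * (∑[ j ← allFin n ] ⟦ Dec.¬? (j ∈? B) ⟧ * weight r (word B) j) ≡ 0ℤ
      cancel B (yes (refl , l<n)) = trans (cong ((1ℤ * f (word B)) *_) (weights-cancel r B (ℕ.<-trans (ℕ.n<1+n (size B)) l<n)))
        (*-zeroʳ (1ℤ * f (word B)))
      cancel B (no _) = trans (cong (_* S) (*-zeroˡ (f (word B)))) (*-zeroˡ S)
        where S = ∑[ j ← allFin n ] ⟦ Dec.¬? (j ∈? B) ⟧ * weight r (word B) j

  -- Induction by `∂-++`. In the first summand the tail is held fixed and the leading block is
  -- summed at the image of `r` under that tail, so `sum-∂-blocks` is applied at varying points. In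
  -- the second the leading block is held fixed and absorbed into `f`.
  sum-∂-tuples : ∀ α r f → Respecting f → (∑[ as ← choices (map blocks α) ] ∂ r (concat as) f) ≡ 0ℤ
  sum-∂-tuples []      r f resp = refl
  sum-∂-tuples (l ∷ α) r f resp = begin
    (∑[ as ← choices (map blocks (l ∷ α)) ] ∂ r (concat as) f)
      ≡⟨ sum-cartesianProductWith _∷_ (blocks l) T _ ⟩
    (∑[ a ← blocks l ] ∑[ as ← T ] ∂ r (a ++ concat as) f)
      ≡⟨ sum-cong (blocks l) (λ a → trans (sum-cong T (λ as → ∂-++ r a (concat as) f)) (sum-+ T (first a) (second a))) ⟩
    (∑[ a ← blocks l ] (sumOver T (first a) + sumOver T (second a)))
      ≡⟨ sum-+ (blocks l) (λ a → sumOver T (first a)) (λ a → sumOver T (second a)) ⟩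
    (∑[ a ← blocks l ] ∑[ as ← T ] first a as) + (∑[ a ← blocks l ] ∑[ as ← T ] second a as)
      ≡⟨ cong₂ _+_
           (trans (sum-swap (blocks l) T first) (sum-zero T λ {as} _ →
             sum-∂-blocks (to (eval (concat as)) r) (λ g → f (g ++ concat as)) (λ {a} {b} e → resp λ i → trans (eval-++ a (concat as) i)
               (trans (e (to (eval (concat as)) i)) (sym (eval-++ b (concat as) i)))) l))
           (sum-zero (blocks l) λ {a} _ → sum-∂-tuples α r (λ g → f (a ++ g)) λ {b} {c} e → resp λ i → trans (eval-++ a b i)
             (trans (cong (to (eval a)) (e i)) (sym (eval-++ a c i)))) ⟩
    0ℤ ∎
    where
    open ≡-Reasoning
    T = choices (map blocks α)
    first second : Word → List Word → ℤ
    first  a as = ∂ (to (eval (concat as)) r) a (λ g → f (g ++ concat as))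
    second a as = ∂ r (concat as) (λ g → f (a ++ g))

  -- Decompositions as tuples of block words, and the resulting coefficients.

  word-setoid : Setoid 0ℓ 0ℓ
  word-setoid = On.setoid S̃-setoid eval

  words-setoid : Setoid 0ℓ 0ℓ
  words-setoid = Pointwise.setoid word-setoid

  tuples : List ℕ → List (List Word)
  tuples α = choices (map blocks α)

  ∈-tuples⁻ : ∀ α {as} → as ∈ tuples α → Pointwise (λ l a → a ∈ blocks l) α as
  ∈-tuples⁻ []      (here refl) = []
  ∈-tuples⁻ (l ∷ α) as∈ with Mem.∈-cartesianProductWith⁻ _∷_ (blocks l) (tuples α) as∈
  ... | a , as , a∈ , as∈′ , refl = a∈ ∷ ∈-tuples⁻ α as∈′

  ∈-tuples⁺ : ∀ {α as} → Pointwise (λ l a → a ∈ blocks l) α as → as ∈ tuples α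
  ∈-tuples⁺ []        = here refl
  ∈-tuples⁺ (a∈ ∷ ps) = Mem.∈-cartesianProductWith⁺ _∷_ a∈ (∈-tuples⁺ ps)

  -- Injectivity is required on the list only, because `eval-word-injective` concerns proper
  -- subsets.
  map-unique : ∀ {A : Set} (f : A → Word) {xs} → (∀ {x y} → x ∈ xs → y ∈ xs → eval (f x) ≈ eval (f y) → x ≡ y) →
               Distinct xs → Unique.Unique word-setoid (map f xs)
  map-unique f {[]}     inj []       = []
  map-unique f {x ∷ xs} inj (x∉ ∷ u) =
    All.map⁺ (All.tabulate λ y∈ e → All.lookup x∉ y∈ (inj (here refl) (there y∈) e)) ∷
    map-unique f (λ x∈ y∈ → inj (there x∈) (there y∈)) u

  blocks-unique : ∀ l → Unique.Unique word-setoid (blocks l)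
  blocks-unique l = map-unique word (λ {A} {B} A∈ B∈ → eval-word-injective (small A∈) (small B∈))
    (Distinct.filter⁺ (hasSize? l) (subsets-distinct n))
    where
    small : ∀ {A} → A ∈ filter (hasSize? l) (subsets n) → size A ℕ.< n
    small A∈ = let _ , e , l<n = ∈-filter⁻ (hasSize? l) {xs = subsets n} A∈ in subst (ℕ._< n) (sym e) l<n

  tuples-unique : ∀ α → Unique.Unique words-setoid (tuples α)
  tuples-unique []      = [] ∷ []
  tuples-unique (l ∷ α) = Unique.cartesianProductWith⁺ word-setoid words-setoid words-setoid _∷_
    (λ { (p ∷ ps) → p , ps }) (blocks-unique l) (tuples-unique α)

  product-eval : ∀ as → eval (concat as) ≈ product (map eval as)
  product-eval []       i = refl
  product-eval (a ∷ as) i = trans (eval-++ a (concat as) i) (cong (to (eval a)) (product-eval as i))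

  length-concat : ∀ {α as} → Pointwise (λ l a → a ∈ blocks l) α as → length (concat as) ≡ ℕ.sum α
  length-concat []                                 = refl
  length-concat (_∷_ {l} {y = a} {ys = as} a∈ ps) = trans (List.length-++ a) (cong₂ ℕ._+_ (block-length l a∈) (length-concat ps))

  Factors : List ℕ → List S̃ → Set
  Factors = Pointwise λ l u → CyclicallyDecreasing u × ℓ u ≡ l

  factors : ∀ {α as} → Pointwise (λ l a → a ∈ blocks l) α as → Factors α (map eval as)
  factors []                       = []
  factors (_∷_ {l} {y = a} a∈ ps) = ((a , descending⇒cyclic d , λ _ → refl) , trans (descending-length d) (block-length l a∈)) ∷ factors ps
    where d = block-descending l a∈

  represent-cyclic : ∀ {l u} → CyclicallyDecreasing u → ℓ u ≡ l → ∃ λ b → b ∈ blocks l × u ≈ eval b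
  represent-cyclic {u = u} (a , cd , e) refl =
    let d = cyclic⇒descending cd
        b , b∈ , eb = represent d
    in b , subst (λ l → b ∈ blocks l) (trans (sym (descending-length d)) (ℓ-cong {eval a} {u} e)) b∈ , λ i → sym (trans (eb i) (e i))

  represent-tuple : ∀ {α ws} → Factors α ws → ∃ λ as → Pointwise (λ l a → a ∈ blocks l) α as × Pointwise _≈_ ws (map eval as)
  represent-tuple []                = [] , [] , []
  represent-tuple ((cd , len) ∷ ps) =
    let a , a∈ , e = represent-cyclic cd len
        as , as∈ , es = represent-tuple ps
    in a ∷ as , a∈ ∷ as∈ , e ∷ es

  -- Every tuple of cyclically decreasing factors has exactly one representative in `tuples α`:
  -- existence is `represent-tuple`, and `tuples-unique` compares words by their values.
  card-decompositions : ∀ α w → + card (decompositions α w) ≡ (∑[ as ← tuples α ] ⟦ eval (concat as) ≟ w ⟧)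
  card-decompositions α w = begin
    + card (decompositions α w)                           ≡⟨ cong +_ (length-unique tuple-decSetoid (Finite.distinct D) unique ⊆ ⊇) ⟩
    + length (map (map eval) selected)                    ≡⟨ cong +_ (List.length-map (map eval) selected) ⟩
    + length selected                                     ≡⟨ sum-one selected ⟨
    (∑[ as ← selected ] 1ℤ)                               ≡⟨ sum-filter has? (tuples α) (λ _ → 1ℤ) ⟩
    (∑[ as ← tuples α ] ⟦ eval (concat as) ≟ w ⟧ * 1ℤ)    ≡⟨ sum-cong (tuples α) (λ as → *-identityʳ ⟦ eval (concat as) ≟ w ⟧) ⟩
    (∑[ as ← tuples α ] ⟦ eval (concat as) ≟ w ⟧)         ∎
    where
    open ≡-Reasoning
    D = decompositions α w
    has? : (as : List Word) → Dec (eval (concat as) ≈ w)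
    has? as = eval (concat as) ≟ w
    selected = filter has? (tuples α)
    unique : Unique.Unique tuple-setoid (map (map eval) selected)
    unique = Unique.map⁺ words-setoid tuple-setoid (Pointwise.map⁻ eval eval)
      (Unique.filter⁺ words-setoid has? (tuples-unique α))
    ⊆ : ∀ {ws} → SMem._∈_ tuple-setoid ws (elements D) → SMem._∈_ tuple-setoid ws (map (map eval) selected)
    ⊆ {ws} ws∈ =
      let fs , e = Finite.sound D ws∈
          as , as∈ , es = represent-tuple fs
      in AnyP.map⁺ (lose (∈-filter⁺ has? (∈-tuples⁺ as∈)
           (λ i → trans (product-eval as i) (trans (sym (product-cong es i)) (sym (e i))))) es)
    ⊇ : ∀ {ws} → SMem._∈_ tuple-setoid ws (map (map eval) selected) → SMem._∈_ tuple-setoid ws (elements D)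
    ⊇ {ws} ws∈ =
      let as , as∈ , es = find (AnyP.map⁻ ws∈)
          as∈T , e = ∈-filter⁻ has? {xs = tuples α} as∈
      in Finite.complete D (decomposition-resp α w (Setoid.sym tuple-setoid es)
           (factors (∈-tuples⁻ α as∈T) , λ i → trans (sym (e i)) (product-eval as i)))

  -- All elements of `X` have length `L`, so they share the guard in `F̃`. After the sums are
  -- swapped, `count` reduces the inner one to whether the product of the tuple satisfies `P`.
  sum-F̃ : ∀ {P : Pred S̃ 0ℓ} (X : Finite S̃-setoid P) (P? : Decidable P) L → (∀ {u} → P u → ℓ u ≡ L) → ∀ α →
          + ((∑[ u ∈ X ] F̃ u) α) ≡ ⟦ ℕ.sum α ℕ.≟ L ⟧ * (∑[ as ← tuples α ] ⟦ P? (eval (concat as)) ⟧)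
  sum-F̃ {P} X P? L length-L α = trans (sum-ℕ (elements X) (λ u → F̃ u α)) (by-cases (ℕ.sum α ℕ.≟ L))
    where
    open ≡-Reasoning
    len : ∀ {u} → u ∈ elements X → ℓ u ≡ L
    len u∈ = length-L (Finite.sound X (Any.map (λ { refl _ → refl }) u∈))
    by-cases : (d : Dec (ℕ.sum α ≡ L)) → (∑[ u ← elements X ] + F̃ u α) ≡ ⟦ d ⟧ * (∑[ as ← tuples α ] ⟦ P? (eval (concat as)) ⟧)
    by-cases (no ¬e) = trans
      (sum-zero (elements X) λ {u} u∈ → cong +_ (if-no (ℕ.sum α ℕ.≟ ℓ u) λ e → ¬e (trans e (len u∈))))
      (sym (*-zeroˡ (∑[ as ← tuples α ] ⟦ P? (eval (concat as)) ⟧)))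
    by-cases (yes e) = begin
      (∑[ u ← elements X ] + F̃ u α)
        ≡⟨ sum-cong-∈ (elements X) (λ {u} u∈ → trans (cong +_ (if-yes (ℕ.sum α ℕ.≟ ℓ u) (trans e (sym (len u∈))))) (card-decompositions α u)) ⟩
      (∑[ u ← elements X ] ∑[ as ← tuples α ] ⟦ eval (concat as) ≟ u ⟧)
        ≡⟨ sum-swap (elements X) (tuples α) _ ⟩
      (∑[ as ← tuples α ] ∑[ u ← elements X ] ⟦ eval (concat as) ≟ u ⟧)
        ≡⟨ sum-cong (tuples α) (λ as → count S̃-decSetoid P? (Finite.distinct X) (eval (concat as)) (Finite.complete X) (Finite.sound X)) ⟩
      (∑[ as ← tuples α ] ⟦ P? (eval (concat as)) ⟧)
        ≡⟨ *-identityˡ _ ⟨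
      1ℤ * (∑[ as ← tuples α ] ⟦ P? (eval (concat as)) ⟧) ∎

  -- Reduced or not, `concat as` has `suc (ℓ v)` letters, so `cover-difference` turns the difference
  -- of the two counts into a sum of ∂ over all tuples.
  covers-balance : ∀ r v α → ℕ.sum α ≡ suc (ℓ v) →
    (∑[ as ← tuples α ] ⟦ left? r v (eval (concat as)) ⟧) ≡ (∑[ as ← tuples α ] ⟦ right? r v (eval (concat as)) ⟧)
  covers-balance r v α len = sym (i-j≡0⇒i≡j _ _ (begin
    (∑[ as ← tuples α ] R as) - (∑[ as ← tuples α ] L as)
      ≡⟨ sum-- (tuples α) R L ⟨
    (∑[ as ← tuples α ] (R as - L as))
      ≡⟨ sum-cong-∈ (tuples α) (λ {as} as∈ → cover-difference r (concat as) v (trans (length-concat (∈-tuples⁻ α as∈)) len)) ⟨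
    (∑[ as ← tuples α ] ∂ r (concat as) (λ g → ⟦ eval g ≟ v ⟧))
      ≡⟨ sum-∂-tuples α r (λ g → ⟦ eval g ≟ v ⟧) (λ {a} {b} e → ⟦⟧-cong (eval a ≟ v) (eval b ≟ v)
           (λ p i → trans (sym (e i)) (p i)) (λ p i → trans (e i) (p i))) ⟩
    0ℤ ∎))
    where
    open ≡-Reasoning
    R L : List Word → ℤ
    R as = ⟦ right? r v (eval (concat as)) ⟧
    L as = ⟦ left? r v (eval (concat as)) ⟧

theorem7 : (n : ℕ) (2≤n : 2 ℕ.≤ n) →
    let open AffineSymmetricGroup n 2≤n in
    (v : S̃) (r : ℤ) →
    (∑[ u ∈ Ψ⁻ r v ] F̃ u) ≗ (∑[ w ∈ Ψ⁺ r v ] F̃ w)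
theorem7 n 2≤n v r α = +-injective (begin
  + ((∑[ u ∈ Ψ⁻ r v ] F̃ u) α)
    ≡⟨ sum-F̃ (Ψ⁻ r v) (left? r v) (suc (ℓ v)) (λ ((_ , len) , _) → len) α ⟩
  ⟦ ℕ.sum α ℕ.≟ suc (ℓ v) ⟧ * (∑[ as ← tuples α ] ⟦ left? r v (eval (concat as)) ⟧)
    ≡⟨ by-cases (ℕ.sum α ℕ.≟ suc (ℓ v)) ⟩
  ⟦ ℕ.sum α ℕ.≟ suc (ℓ v) ⟧ * (∑[ as ← tuples α ] ⟦ right? r v (eval (concat as)) ⟧)
    ≡⟨ sum-F̃ (Ψ⁺ r v) (right? r v) (suc (ℓ v)) (λ ((_ , len) , _) → len) α ⟨
  + ((∑[ w ∈ Ψ⁺ r v ] F̃ w) α) ∎)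
  where
  open ≡-Reasoning
  open AffineSymmetricGroup n 2≤n
  open Transition n 2≤n
  by-cases : (d : Dec (ℕ.sum α ≡ suc (ℓ v))) →
    ⟦ d ⟧ * (∑[ as ← tuples α ] ⟦ left? r v (eval (concat as)) ⟧) ≡
    ⟦ d ⟧ * (∑[ as ← tuples α ] ⟦ right? r v (eval (concat as)) ⟧)
  by-cases (yes len) = cong (1ℤ *_) (covers-balance r v α len)
  by-cases (no _)    = trans (*-zeroˡ (∑[ as ← tuples α ] ⟦ left? r v (eval (concat as)) ⟧))
    (sym (*-zeroˡ (∑[ as ← tuples α ] ⟦ right? r v (eval (concat as)) ⟧)))
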